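{- Let $n\ge1$, $\mathbf{m}=(m_1,\dots,m_n)$ a vector of positive integers, $m=m_1+\cdots+m_n$, $r\ge1$ an integer and $\mathbf{r}=(r,\dots,r)\in\mathbb{Z}^n$. Then, as formal power series in $z_0,z_1,\dots,z_n$, $$\sum_{\pi^{\mathbf{c}}\in\mathfrak{S}_{\mathbf{m}}^{\mathbf{r}}}\frac{\prod_{i=1}^{m}(z_0z_{\pi_1}\cdots z_{\pi_i})^{a_i(\pi^{\mathbf{c}})}\ \prod_{\substack{i\in\mathrm{DES}(\pi^{\mathbf{c}})\\ a_i(\pi^{\mathbf{c}})=0}}(z_0z_{\pi_1}\cdots z_{\pi_i})^{r}}{(1-z_0)\prod_{i=1}^{m}\bigl(1-(z_0z_{\pi_1}\cdots z_{\pi_i})^{r}\bigr)}=\sum_{t\ge0}z_0^t\prod_{k=1}^n\begin{bmatrix}t+m_k\\ m_k\end{bmatrix}_{z_k}.$$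
   Context: $\mathfrak{S}_{\mathbf{m}}^{\mathbf{r}}$ (here with $\mathbf{r}=(r,\dots,r)$) denotes the set of colored multiset permutations: words $\pi^{\mathbf{c}}=\pi_1^{c_1}\pi_2^{c_2}\cdots\pi_m^{c_m}$ in which each $k\in\{1,\dots,n\}$ appears exactly $m_k$ times among $\pi_1,\dots,\pi_m$, and each color $c_j$ is an integer with $1\le c_j\le r$. One always appends $\pi_{m+1}^{c_{m+1}}:=(n+1)^1$, so $c_{m+1}=1$. Colored letters are totally ordered by the color ordering: $k^{c}<l^{c'}$ iff $c<c'$, or $c=c'$ and $k<l$. An index $j\in\{1,\dots,m\}$ is a descent of $\pi^{\mathbf{c}}$ if $\pi_j^{c_j}>\pi_{j+1}^{c_{j+1}}$; $\mathrm{DES}(\pi^{\mathbf{c}})$ is the set of descents. For $j\in\{1,\dots,m\}$, the $j$-th color change $a_j(\pi^{\mathbf{c}})\in\{0,1,\dots,r-1\}$ is the residue of $c_j-c_{j+1}$ modulo $r$. $\begin{bmatrix}N\\ M\end{bmatrix}_q$ is the Gaussian ($q$-)binomial coefficient $\prod_{i=1}^{M}\frac{1-q^{N-M+i}}{1-q^i}$. -}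

module Defs where

open import Algebra.Bundles.Raw using (RawRing)
import Algebra.Definitions.RawSemiring as RawSemiringDefinitions
open import Data.Bool.Base using (if_then_else_)
open import Data.Fin.Base as Fin using (Fin; toℕ; inject₁)
import Data.Fin.Properties as Fin
open import Data.Integer.Base as ℤ using (ℤ; +_; 0ℤ; 1ℤ; _%ℕ_)
import Data.Integer.Properties as ℤ
open import Data.Integer.Solver using (module +-*-Solver)
open import Data.List.Base as List
  using (List; []; _∷_; allFin; applyUpTo; cartesianProduct; cartesianProductWith; upTo)
open import Data.List.Membership.Propositional.Properties using (∈-applyUpTo⁻; ∈-upTo⁻)
import Data.List.Properties as List
open import Data.List.Relation.Unary.All as All using (All; []; _∷_)
import Data.List.Relation.Unary.All.Properties as All
open import Data.Nat.Base as ℕ using (ℕ; zero; suc; _∸_; NonZero)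
import Data.Nat.Properties as ℕ
import Data.Nat.Solver as ℕSolver
open import Data.Product.Base using (_×_; _,_; proj₁; proj₂)
open import Data.Sum.Base using (_⊎_)
open import Data.Vec.Base as Vec using (Vec; []; _∷_; _∷ʳ_; lookup; zipWith; _[_]≔_)
import Data.Vec.Properties as Vec
open import Function.Base using (case_of_)
open import Relation.Binary.Core using (Rel)
open import Relation.Binary.Definitions using (Decidable)
open import Relation.Binary.PropositionalEquality
  using (_≡_; refl; sym; trans; cong; cong₂; setoid; module ≡-Reasoning)
open import Relation.Nullary.Decidable using (does; dec-true; _×-dec_; _⊎-dec_)
import Relation.Unary as U

------------------------------------------------------------------------
-- Formal power series over ℤ

private
  variable
    A : Set
    M N n r : ℕ

-- A series in N variables is its family of coefficients, indexed by exponent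
-- vectors.
PowerSeries : ℕ → Set
PowerSeries N = Vec ℕ N → ℤ

degree : Vec ℕ N → ℕ
degree = Vec.sum

sumℤ : List ℤ → ℤ
sumℤ = List.foldr ℤ._+_ 0ℤ

-- All exponent vectors d with d ≤ e componentwise.
below : Vec ℕ N → List (Vec ℕ N)
below []      = [] ∷ []
below (x ∷ e) = cartesianProductWith _∷_ (upTo (suc x)) (below e)

monomial : Vec ℕ N → PowerSeries N
monomial d e = if does (Vec.≡-dec ℕ._≟_ d e) then 1ℤ else 0ℤ

var : Fin N → PowerSeries N
var {N} j = monomial (Vec.replicate N 0 [ j ]≔ 1)

powerSeriesRawRing : ℕ → RawRing _ _
powerSeriesRawRing N = record
  { Carrier = PowerSeries N
  ; _≈_     = λ f g → ∀ e → f e ≡ g e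
  ; _+_     = λ f g e → f e ℤ.+ g e
  ; _*_     = λ f g e → sumℤ (List.map (λ d → f d ℤ.* g (zipWith _∸_ e d)) (below e))
  ; -_      = λ f e → ℤ.- f e
  ; 0#      = λ _ → 0ℤ
  ; 1#      = monomial (Vec.replicate N 0)
  }

module _ {N : ℕ} where
  open RawRing (powerSeriesRawRing N) public
    using (_≈_; _+_; _*_; -_; 0#; 1#)
  open RawSemiringDefinitions (RawRing.rawSemiring (powerSeriesRawRing N)) public
    using (_^_) renaming (product to ∏)

infixl 6 _-_
_-_ : PowerSeries N → PowerSeries N → PowerSeries N
f - g = f + (- g)

Σ-list : List A → (A → PowerSeries N) → PowerSeries N
Σ-list xs f = List.foldr (λ x s → f x + s) 0# xs

-- The sum of a sequence of series in which the t-th one has no terms of degree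
-- less than t: only the terms with t ≤ degree e contribute to the coefficient
-- at e.  See Σ∞-converges.
Σ∞ : (ℕ → PowerSeries N) → PowerSeries N
Σ∞ f e = sumℤ (applyUpTo (λ t → f t e) (suc (degree e)))

-- The inverse of a series with constant coefficient 1 (and a junk value for
-- any other series), as a geometric series.  See *-inverseʳ.
infix 8 _⁻¹
_⁻¹ : PowerSeries N → PowerSeries N
f ⁻¹ = Σ∞ (λ k → (1# - f) ^ k)

infixl 7 _÷_
_÷_ : PowerSeries N → PowerSeries N → PowerSeries N
f ÷ g = f * g ⁻¹

-- In products over Fin M the 0-based index i stands for the index suc (toℕ i)
-- of the usual 1-based product.
gaussian : PowerSeries N → ℕ → ℕ → PowerSeries N
gaussian q a b = ∏ {n = b} λ i →
  (1# - q ^ ((a ∸ b) ℕ.+ suc (toℕ i))) ÷ (1# - q ^ suc (toℕ i))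

------------------------------------------------------------------------
-- Coloured multiset permutations

-- The pair (k , c) is the letter k with colour c.
ColouredLetter : Set
ColouredLetter = ℕ × ℕ

infix 4 _<ᶜ_ _<ᶜ?_
_<ᶜ_ : Rel ColouredLetter _
(k , c) <ᶜ (l , d) = c ℕ.< d ⊎ (c ≡ d × k ℕ.< l)

_<ᶜ?_ : Decidable _<ᶜ_
(k , c) <ᶜ? (l , d) = (c ℕ.<? d) ⊎-dec ((c ℕ.≟ d) ×-dec (k ℕ.<? l))

-- A letter k : Fin n stands for suc (toℕ k) ∈ {1,…,n}, and a colour c : Fin r
-- for suc (toℕ c) ∈ {1,…,r}.
Word : ℕ → ℕ → ℕ → Set
Word n r M = Vec (Fin n × Fin r) M

HasMultiplicities : Vec ℕ n → Word n r M → Set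
HasMultiplicities mult w =
  ∀ k → Vec.count (k Fin.≟_) (Vec.map proj₁ w) ≡ lookup mult k

hasMultiplicities? : (mult : Vec ℕ n) → U.Decidable (HasMultiplicities {r = r} {M} mult)
hasMultiplicities? mult w = Fin.all? λ k → _ ℕ.≟ _

vecsOver : List A → (M : ℕ) → List (Vec A M)
vecsOver xs zero    = [] ∷ []
vecsOver xs (suc M) = cartesianProductWith _∷_ xs (vecsOver xs M)

colouredPermutations : (mult : Vec ℕ n) (r : ℕ) → List (Word n r (Vec.sum mult))
colouredPermutations {n} mult r =
  List.filter (hasMultiplicities? mult)
    (vecsOver (cartesianProduct (allFin n) (allFin r)) (Vec.sum mult))

-- The word followed by the letter n+1 of colour 1.
extend : Word n r M → Vec ColouredLetter (suc M)
extend {n} w = Vec.map (λ (k , c) → suc (toℕ k) , suc (toℕ c)) w ∷ʳ (suc n , 1)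

current next : Word n r M → Fin M → ColouredLetter
current w i = lookup (extend w) (inject₁ i)
next    w i = lookup (extend w) (Fin.suc i)

Descent : Word n r M → Fin M → Set
Descent w i = next w i <ᶜ current w i

descent? : (w : Word n r M) → U.Decidable (Descent w)
descent? w i = next w i <ᶜ? current w i

colourChange : .{{_ : NonZero r}} → Word n r M → Fin M → ℕ
colourChange {r} w i = (+ proj₂ (current w i) ℤ.- + proj₂ (next w i)) %ℕ r

-- z₀ z_{π₁} ⋯ z_{πᵢ}
prefixProduct : Word n r M → Fin M → PowerSeries (suc n)
prefixProduct w i =
  var Fin.zero * ∏ {n = suc (toℕ i)} λ j → var (Fin.suc (proj₁ (lookup w (Fin.inject≤ j (Fin.toℕ<n i)))))

numerator : .{{_ : NonZero r}} → Word n r M → PowerSeries (suc n)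
numerator {r} w =
  ∏ (λ i → prefixProduct w i ^ colourChange w i) *
  ∏ (λ i → if does (descent? w i ×-dec (colourChange w i ℕ.≟ 0))
           then prefixProduct w i ^ r
           else 1#)

denominator : Word n r M → PowerSeries (suc n)
denominator {r = r} w =
  (1# - var Fin.zero) * ∏ (λ i → 1# - prefixProduct w i ^ r)

------------------------------------------------------------------------
-- Σ∞ is the coefficientwise limit of partial sums, and _⁻¹ is an inverse

open +-*-Solver using (solve; _:+_; _:-_; _:*_; _:=_)
private module ℕS = ℕSolver.+-*-Solver

private
  sum-cong : {f g : A → ℤ} {xs : List A} → All (λ x → f x ≡ g x) xs →
             sumℤ (List.map f xs) ≡ sumℤ (List.map g xs)
  sum-cong []       = refl
  sum-cong (p ∷ ps) = cong₂ ℤ._+_ p (sum-cong ps)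

  sum-zero : {f : A → ℤ} {xs : List A} → All (λ x → f x ≡ 0ℤ) xs →
             sumℤ (List.map f xs) ≡ 0ℤ
  sum-zero []       = refl
  sum-zero (p ∷ ps) = cong₂ ℤ._+_ p (sum-zero ps)

  sum-- : (f g : A → ℤ) (xs : List A) →
          sumℤ (List.map (λ x → f x ℤ.- g x) xs) ≡
          sumℤ (List.map f xs) ℤ.- sumℤ (List.map g xs)
  sum-- f g []       = refl
  sum-- f g (x ∷ xs) = trans (cong (ℤ._+_ (f x ℤ.- g x)) (sum-- f g xs))
    (solve 4 (λ a b c d → ((a :- b) :+ (c :- d)) := ((a :+ c) :- (b :+ d)))
       refl (f x) (g x) (sumℤ (List.map f xs)) (sumℤ (List.map g xs)))

  sum-++ : (xs ys : List ℤ) → sumℤ (xs List.++ ys) ≡ sumℤ xs ℤ.+ sumℤ ys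
  sum-++ []       ys = sym (ℤ.+-identityˡ _)
  sum-++ (x ∷ xs) ys = trans (cong (ℤ._+_ x) (sum-++ xs ys)) (sym (ℤ.+-assoc x _ _))

  partial : (ℕ → ℤ) → ℕ → ℤ
  partial f M = sumℤ (applyUpTo f M)

  partial-cong : {f g : ℕ → ℤ} → (∀ t → f t ≡ g t) → ∀ M → partial f M ≡ partial g M
  partial-cong f≗g zero    = refl
  partial-cong f≗g (suc M) = cong₂ ℤ._+_ (f≗g 0) (partial-cong (λ t → f≗g (suc t)) M)

  partial-zero : {f : ℕ → ℤ} → (∀ t → f t ≡ 0ℤ) → ∀ M → partial f M ≡ 0ℤ
  partial-zero f≗0 zero    = refl
  partial-zero f≗0 (suc M) = cong₂ ℤ._+_ (f≗0 0) (partial-zero (λ t → f≗0 (suc t)) M)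

  partial-stable : {f : ℕ → ℤ} {L : ℕ} → (∀ t → L ℕ.≤ t → f t ≡ 0ℤ) →
                   ∀ {M} → L ℕ.≤ M → partial f M ≡ partial f L
  partial-stable f≡0 {M} ℕ.z≤n   = partial-zero (λ t → f≡0 t ℕ.z≤n) M
  partial-stable {f} f≡0 (ℕ.s≤s p) =
    cong (ℤ._+_ (f 0)) (partial-stable (λ t q → f≡0 (suc t) (ℕ.s≤s q)) p)

  partial-telescope : (f : ℕ → ℤ) → ∀ M → partial (λ t → f t ℤ.- f (suc t)) M ≡ f 0 ℤ.- f M
  partial-telescope f zero    = sym (ℤ.+-inverseʳ (f 0))
  partial-telescope f (suc M) =
    trans (cong (ℤ._+_ (f 0 ℤ.- f 1)) (partial-telescope (λ t → f (suc t)) M))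
      (solve 3 (λ a b c → ((a :- b) :+ (b :- c)) := (a :- c)) refl (f 0) (f 1) (f (suc M)))

  *-partial : (a : ℤ) (f : ℕ → ℤ) → ∀ M → a ℤ.* partial f M ≡ partial (λ t → a ℤ.* f t) M
  *-partial a f zero    = ℤ.*-zeroʳ a
  *-partial a f (suc M) = trans (ℤ.*-distribˡ-+ a (f 0) _)
    (cong (ℤ._+_ (a ℤ.* f 0)) (*-partial a (λ t → f (suc t)) M))

  sum-partial : (f : A → ℕ → ℤ) (xs : List A) → ∀ M →
                sumℤ (List.map (λ x → partial (f x) M) xs) ≡
                partial (λ t → sumℤ (List.map (λ x → f x t) xs)) M
  sum-partial f []       M = sym (partial-zero (λ _ → refl) M)
  sum-partial f (x ∷ xs) M = trans (cong (ℤ._+_ (partial (f x) M)) (sum-partial f xs M)) (add M (f x) _)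
    where
    add : ∀ M (g h : ℕ → ℤ) → partial g M ℤ.+ partial h M ≡ partial (λ t → g t ℤ.+ h t) M
    add zero    g h = refl
    add (suc M) g h = trans
      (solve 4 (λ a b c d → ((a :+ b) :+ (c :+ d)) := ((a :+ c) :+ (b :+ d))) refl
         (g 0) (partial (λ t → g (suc t)) M) (h 0) (partial (λ t → h (suc t)) M))
      (cong (ℤ._+_ (g 0 ℤ.+ h 0)) (add M (λ t → g (suc t)) (λ t → h (suc t))))

  zeros : Vec ℕ N
  zeros = Vec.replicate _ 0

  degree≡0 : (e : Vec ℕ N) → degree e ≡ 0 → e ≡ zeros
  degree≡0 []         _ = refl
  degree≡0 (zero ∷ e) p = cong (0 ∷_) (degree≡0 e p)

  All-below : (P : Vec ℕ N → Set) (e : Vec ℕ N) →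
              (∀ d → degree d ℕ.+ degree (zipWith _∸_ e d) ≡ degree e → P d) → All P (below e)
  All-below P e h = All.map (h _) (go e)
    where
    interchange : ∀ a b c d → (a ℕ.+ b) ℕ.+ (c ℕ.+ d) ≡ (a ℕ.+ c) ℕ.+ (b ℕ.+ d)
    interchange = ℕS.solve 4 (λ a b c d →
      (a ℕS.:+ b) ℕS.:+ (c ℕS.:+ d) ℕS.:= (a ℕS.:+ c) ℕS.:+ (b ℕS.:+ d)) refl
    go : (e : Vec ℕ N) → All (λ d → degree d ℕ.+ degree (zipWith _∸_ e d) ≡ degree e) (below e)
    go []      = refl ∷ []
    go (x ∷ e) = All.cartesianProductWith⁺ (setoid _) (setoid _) _∷_ (upTo (suc x)) (below e)
      λ {y} {d} y∈ d∈ → trans (interchange y (degree d) (x ∸ y) _)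
        (cong₂ ℕ._+_ (ℕ.m+[n∸m]≡n (ℕ.≤-pred (∈-upTo⁻ y∈))) (All.lookup (go e) d∈))

  *-identityˡ : (g : PowerSeries N) → 1# * g ≈ g
  *-identityˡ g [] = trans (ℤ.+-identityʳ _) (ℤ.*-identityˡ _)
  *-identityˡ {suc N} g (x ∷ e) = begin
    sumℤ (List.map h (List.map (0 ∷_) (below e) List.++ rest))
      ≡⟨ cong sumℤ (List.map-++ h (List.map (0 ∷_) (below e)) rest) ⟩
    sumℤ (List.map h (List.map (0 ∷_) (below e)) List.++ List.map h rest)
      ≡⟨ sum-++ (List.map h (List.map (0 ∷_) (below e))) (List.map h rest) ⟩
    sumℤ (List.map h (List.map (0 ∷_) (below e))) ℤ.+ sumℤ (List.map h rest)
      ≡⟨ cong₂ ℤ._+_ (cong sumℤ (sym (List.map-∘ (below e)))) (sum-zero rest≡0) ⟩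
    sumℤ (List.map (λ d → h (0 ∷ d)) (below e)) ℤ.+ 0ℤ
      ≡⟨ ℤ.+-identityʳ _ ⟩
    sumℤ (List.map (λ d → h (0 ∷ d)) (below e))
      ≡⟨ *-identityˡ (λ d → g (x ∷ d)) e ⟩
    g (x ∷ e) ∎
    where
    open ≡-Reasoning
    h : Vec ℕ (suc N) → ℤ
    h d = 1# d ℤ.* g (zipWith _∸_ (x ∷ e) d)
    rest : List (Vec ℕ (suc N))
    rest = cartesianProductWith _∷_ (applyUpTo suc x) (below e)
    rest≡0 : All (λ d → h d ≡ 0ℤ) rest
    rest≡0 = All.cartesianProductWith⁺ (setoid _) (setoid _) _∷_ (applyUpTo suc x) (below e)
      λ y∈ _ → case ∈-applyUpTo⁻ suc y∈ of λ where (_ , _ , refl) → refl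

  ^-order : (u : PowerSeries N) → u zeros ≡ 0ℤ →
            ∀ k e → degree e ℕ.< k → (u ^ k) e ≡ 0ℤ
  ^-order u u₀ (suc k) e e<k = sum-zero (All-below _ e vanish)
    where
    vanish : ∀ d → degree d ℕ.+ degree (zipWith _∸_ e d) ≡ degree e →
             u d ℤ.* (u ^ k) (zipWith _∸_ e d) ≡ 0ℤ
    vanish d eq with degree d in deg
    ... | zero  = cong (ℤ._* (u ^ k) (zipWith _∸_ e d)) (trans (cong u (degree≡0 d deg)) u₀)
    ... | suc n = trans
      (cong (u d ℤ.*_) (^-order u u₀ k _
        (ℕ.<-≤-trans (ℕ.s≤s (ℕ.m≤n+m _ n)) (ℕ.≤-trans (ℕ.≤-reflexive eq) (ℕ.≤-pred e<k)))))
      (ℤ.*-zeroʳ (u d))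

Σ∞-converges : (f : ℕ → PowerSeries N) → (∀ t e → degree e ℕ.< t → f t e ≡ 0ℤ) →
               ∀ e M → degree e ℕ.< M → sumℤ (applyUpTo (λ t → f t e) M) ≡ Σ∞ f e
Σ∞-converges f order e M = partial-stable (λ t → order t e)

*-inverseʳ : (f : PowerSeries N) → f (Vec.replicate N 0) ≡ 1ℤ → f * f ⁻¹ ≈ 1#
*-inverseʳ {N} f f₀ e = begin
  (f * f ⁻¹) e
    ≡⟨ sum-cong (All-below _ e λ d eq → trans
         (cong (f d ℤ.*_) (sym (Σ∞-converges (u ^_) order (zipWith _∸_ e d) (suc (degree e))
            (ℕ.s≤s (ℕ.≤-trans (ℕ.m≤n+m _ (degree d)) (ℕ.≤-reflexive eq))))))
         (*-partial (f d) (λ k → (u ^ k) (zipWith _∸_ e d)) (suc (degree e)))) ⟩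
  sumℤ (List.map (λ d → partial (λ k → f d ℤ.* (u ^ k) (zipWith _∸_ e d)) (suc (degree e))) (below e))
    ≡⟨ sum-partial (λ d k → f d ℤ.* (u ^ k) (zipWith _∸_ e d)) (below e) (suc (degree e)) ⟩
  partial (λ k → (f * u ^ k) e) (suc (degree e))
    ≡⟨ partial-cong step (suc (degree e)) ⟩
  partial (λ k → (u ^ k) e ℤ.- (u ^ suc k) e) (suc (degree e))
    ≡⟨ partial-telescope (λ k → (u ^ k) e) (suc (degree e)) ⟩
  1# e ℤ.- (u ^ suc (degree e)) e
    ≡⟨ cong (ℤ._-_ (1# e)) (order (suc (degree e)) e ℕ.≤-refl) ⟩
  1# e ℤ.- 0ℤ
    ≡⟨ ℤ.+-identityʳ _ ⟩
  1# e ∎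
  where
  open ≡-Reasoning
  u : PowerSeries N
  u = 1# - f
  1₀ : 1# {N} zeros ≡ 1ℤ
  1₀ rewrite dec-true (Vec.≡-dec ℕ._≟_ (zeros {N}) zeros) refl = refl
  order : ∀ k e → degree e ℕ.< k → (u ^ k) e ≡ 0ℤ
  order = ^-order u (cong₂ ℤ._-_ 1₀ f₀)
  step : ∀ k → (f * u ^ k) e ≡ (u ^ k) e ℤ.- (u ^ suc k) e
  step k = begin
    (f * u ^ k) e
      ≡⟨ sum-cong {xs = below e} (All.tabulate λ {d} _ → solve 3 (λ a b c →
           (a :* c) := ((b :* c) :- ((b :- a) :* c))) refl (f d) (1# d) ((u ^ k) (zipWith _∸_ e d))) ⟩
    sumℤ (List.map (λ d → 1# d ℤ.* (u ^ k) (zipWith _∸_ e d) ℤ.- u d ℤ.* (u ^ k) (zipWith _∸_ e d)) (below e))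
      ≡⟨ sum-- _ _ (below e) ⟩
    (1# * u ^ k) e ℤ.- (u ^ suc k) e
      ≡⟨ cong (ℤ._- (u ^ suc k) e) (*-identityˡ (u ^ k) e) ⟩
    (u ^ k) e ℤ.- (u ^ suc k) e ∎

-- Once the colour of a letter is summed over, its factor is that of an uncoloured
-- word, because the colour changes run over 0,…,r-1 and
-- (1 + x + ⋯ + xʳ⁻¹) / (1 - xʳ) = 1 / (1 - x).  Hence the sum T(m, κ, x) over the
-- words of multiplicities m that follow a letter κ and a prefix product x satisfies
--   T(m, κ, x) = Σ_k [m_k > 0] x^[k < κ] / (1 - x) · T(m - e_k, k, x z_k).
-- Let A(m, κ, t) be the product over k of the Gaussian coefficients of m_k out of
-- t + m_k if k ≥ κ, and out of t - 1 + m_k if k < κ.  The q-Pascal rule gives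
--   A(m, κ, t) = A(m, κ + 1, t) + [m_κ > 0] z_κᵗ A(m - e_κ, κ, t),
-- and raising κ past the last letter amounts to lowering t by 1, so that
-- Σ_t xᵗ A(m, κ, t) satisfies, by telescoping, the same recursion as T(m, κ, x).

module Submission where

-- Colours can be eliminated one at a time from the left: the colour of a letter enters only its own
-- factor and that of the letter before it. Once the preceding colour has been summed over, with a
-- result that depends on the two letters alone, the next colour occurs in a single factor. For a
-- fixed colour of the successor, the colour changes are a rotation of 0,...,r-1. A descent with
-- colour change 0 has equal colours, hence is a descent of letters; there xʳ replaces x⁰, and 1 + ⋯
-- + xʳ⁻¹ becomes x (1 + ⋯ + xʳ⁻¹). The appended letter n+1 exceeds all others, so it never follows
-- a descent of letters. The factor 1 / (1 - z₀) plays the role of the already summed factor of a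
-- smallest letter in front of the word, so that the theorem is the case κ = 0, x = z₀ of a
-- statement about all κ and x, with letters numbered from 0. This argument never looks at
-- coefficients, so it is carried out over an abstract ring; the power series enter only at the end.

open import Algebra.Bundles using (CommutativeRing)
import Algebra.Properties.CommutativeMonoid.Sum as CommutativeMonoidSum
import Algebra.Properties.CommutativeSemigroup as CommutativeSemigroupProperties
import Algebra.Properties.CommutativeSemiring.Exp as Exp
import Algebra.Properties.Ring as RingProperties
import Algebra.Properties.Semiring.Sum as SemiringSum
import Algebra.Solver.Ring.NaturalCoefficients.Default as NaturalCoefficients
open import Data.Bool.Base using (Bool; true; false; if_then_else_; _∧_)
open import Data.Bool.Properties using (∧-zeroʳ)
open import Data.Fin.Base as Fin using (Fin; zero; suc; toℕ)
import Data.Fin.Properties as Fin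
open import Data.Integer.Base as ℤ using (ℤ; 0ℤ; 1ℤ; -[1+_]; _%ℕ_)
import Data.Integer.Properties as ℤ
open import Data.List.Base as List
  using (List; []; _∷_; allFin; applyUpTo; cartesianProduct; cartesianProductWith; upTo)
open import Data.List.Membership.Propositional.Properties using (∈-upTo⁻)
import Data.List.Properties as List
open import Data.List.Relation.Unary.All as All using (All; []; _∷_)
import Data.List.Relation.Unary.All.Properties as All
open import Data.Nat.Base as ℕ using (ℕ; zero; suc; pred; _∸_; NonZero; _<ᵇ_; _≡ᵇ_)
import Data.Nat.DivMod as ℕ
import Data.Nat.Properties as ℕ
open import Data.Product.Base using (_×_; _,_; proj₁; proj₂)
open import Data.Vec.Base as Vec using (Vec; []; _∷_; lookup; updateAt; zipWith)
import Data.Vec.Properties as Vec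
open import Function.Base using (_∘_; id)
open import Function.Bundles using (mk⇔)
open import Level using (0ℓ)
open import Relation.Binary.PropositionalEquality as ≡
  using (_≡_; _≢_; refl; sym; trans; cong; cong₂; subst; module ≡-Reasoning)
import Relation.Binary.Reasoning.Setoid as SetoidReasoning
open import Relation.Nullary.Decidable using (Dec; does; yes; no; dec-true; dec-false; does-⇔; _×-dec_)
open import Relation.Nullary.Negation using (contradiction)

open import Defs using
  ( ColouredLetter; _<ᶜ?_; Word; HasMultiplicities; hasMultiplicities?; vecsOver
  ; colouredPermutations; extend; current; next)

-- Unital plays the role of "constant term 1", Small that of "constant term 0",
-- and series x a that of Σ_t xᵗ aₜ.
record SeriesRing : Set₁ where
  infix 8 _⁻¹
  field
    commutativeRing : CommutativeRing 0ℓ 0ℓ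
  open CommutativeRing commutativeRing public
    renaming (refl to ≈-refl; sym to ≈-sym; trans to ≈-trans) hiding (zero)
  open Exp commutativeSemiring public
  field
    _⁻¹         : Carrier → Carrier
    series      : Carrier → (ℕ → Carrier) → Carrier
    Unital      : Carrier → Set
    Small       : Carrier → Set
    ⁻¹-cong     : ∀ {x y} → x ≈ y → x ⁻¹ ≈ y ⁻¹
    *-inverseʳ  : ∀ {x} → Unital x → x * x ⁻¹ ≈ 1#
    1#-unital   : Unital 1#
    *-unital    : ∀ {x y} → Unital x → Unital y → Unital (x * y)
    1-small     : ∀ {x} → Small x → Unital (1# - x)
    small-*     : ∀ {x} → Small x → ∀ y → Small (x * y)
    series-cong : ∀ {x y a b} → (∀ t → x ^ t * a t ≈ y ^ t * b t) → series x a ≈ series y b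
    series-+    : ∀ x a b → series x (λ t → a t + b t) ≈ series x a + series x b
    series-suc  : ∀ {x} → Small x → ∀ a → series x a ≈ a 0 + x * series x (a ∘ suc)

-- Division by unital elements, Gaussian coefficients and the q-Pascal rule.

module SeriesRingProperties (G : SeriesRing) where
  open SeriesRing G
  open CommutativeMonoidSum *-commutativeMonoid public
    using () renaming
    ( sum to ∏; sum-cong-≋ to ∏-cong; ∑-distrib-+ to ∏-distrib-*; sum-init-last to ∏-init-last
    ; sum-replicate-zero to ∏-1)
  open SemiringSum semiring public
    using (sum; *-distribˡ-sum; *-distribʳ-sum)
    renaming (sum-cong-≋ to sum-cong; ∑-distrib-+ to sum-distrib-+; sum-replicate-zero to sum-0)
  open RingProperties ring public using (+-cancelʳ)
  module * = CommutativeSemigroupProperties *-commutativeSemigroup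
  module Solver = NaturalCoefficients commutativeSemiring
  open Solver using (solve; _:+_; _:*_; _:=_)
  open SetoidReasoning setoid

  x-y+y≈x : ∀ x y → x - y + y ≈ x
  x-y+y≈x x y = ≈-trans (+-assoc x (- y) y) (≈-trans (+-congˡ (-‿inverseˡ y)) (+-identityʳ x))

  x+y≈z⇒x≈z-y : ∀ {x y z} → x + y ≈ z → x ≈ z - y
  x+y≈z⇒x≈z-y {x} {y} {z} eq = +-cancelʳ y x (z - y) (≈-trans eq (≈-sym (x-y+y≈x z y)))

  -- The source of every closed form with 1 / (1 - x): the geometric series, the finite geometric
  -- sums and the recursion for `familySeries` all arrive as such fixed-point equations.
  fixpoint⇒[1-x]u≈a : ∀ {x u a} → u ≈ a + x * u → (1# - x) * u ≈ a
  fixpoint⇒[1-x]u≈a {x} {u} {a} eq = +-cancelʳ (x * u) _ a (begin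
    (1# - x) * u + x * u  ≈⟨ distribʳ u (1# - x) x ⟨
    (1# - x + x) * u      ≈⟨ *-congʳ (x-y+y≈x 1# x) ⟩
    1# * u                ≈⟨ *-identityˡ u ⟩
    u                     ≈⟨ eq ⟩
    a + x * u             ∎)

  *-unique : ∀ {d u v} → Unital d → d * u ≈ v → u ≈ v * d ⁻¹
  *-unique {d} {u} {v} d-unital eq = begin
    u                ≈⟨ *-identityˡ u ⟨
    1# * u           ≈⟨ *-congʳ (*-inverseʳ d-unital) ⟨
    d * d ⁻¹ * u     ≈⟨ *.xy∙z≈xz∙y d (d ⁻¹) u ⟩
    d * u * d ⁻¹     ≈⟨ *-congʳ eq ⟩
    v * d ⁻¹         ∎

  *-cancelˡ : ∀ {d u v} → Unital d → d * u ≈ d * v → u ≈ v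
  *-cancelˡ d-unital eq = ≈-trans (*-unique d-unital eq) (≈-sym (*-unique d-unital ≈-refl))

  *-÷-cancel : ∀ {d} → Unital d → ∀ u → d * (u * d ⁻¹) ≈ u
  *-÷-cancel {d} d-unital u = begin
    d * (u * d ⁻¹)   ≈⟨ *.x∙yz≈y∙xz d u (d ⁻¹) ⟩
    u * (d * d ⁻¹)   ≈⟨ *-congˡ (*-inverseʳ d-unital) ⟩
    u * 1#           ≈⟨ *-identityʳ u ⟩
    u                ∎

  small-^ : ∀ {x} → Small x → ∀ k → Small (x ^ suc k)
  small-^ {x} x-small k = small-* x-small (x ^ k)

  ∏-unital : ∀ {n} (f : Fin n → Carrier) → (∀ i → Unital (f i)) → Unital (∏ f)
  ∏-unital {zero}  f f-unital = 1#-unital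
  ∏-unital {suc n} f f-unital = *-unital (f-unital zero) (∏-unital (f ∘ suc) (f-unital ∘ suc))

  -- The three products share their factors away from `k`, so this is distributivity. It carries
  -- `pascal` for one letter over to `families`.
  ∏-step : ∀ {n} (k : Fin n) (f g h : Fin n → Carrier) u → f k ≈ g k + u * h k →
    (∀ l → l ≢ k → f l ≈ g l) → (∀ l → l ≢ k → f l ≈ h l) → ∏ f ≈ ∏ g + u * ∏ h
  ∏-step {suc n} zero f g h u eq f≈g f≈h = begin
    f zero * ∏ (f ∘ suc)
      ≈⟨ *-congʳ eq ⟩
    (g zero + u * h zero) * ∏ (f ∘ suc)
      ≈⟨ distribʳ (∏ (f ∘ suc)) (g zero) (u * h zero) ⟩
    g zero * ∏ (f ∘ suc) + u * h zero * ∏ (f ∘ suc)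
      ≈⟨ +-cong (*-congˡ (∏-cong λ l → f≈g (suc l) λ ()))
                (≈-trans (*-assoc u (h zero) _) (*-congˡ (*-congˡ (∏-cong λ l → f≈h (suc l) λ ())))) ⟩
    g zero * ∏ (g ∘ suc) + u * (h zero * ∏ (h ∘ suc)) ∎
  ∏-step {suc n} (suc k) f g h u eq f≈g f≈h = begin
    f zero * ∏ (f ∘ suc)
      ≈⟨ *-congˡ (∏-step k (f ∘ suc) (g ∘ suc) (h ∘ suc) u eq
           (λ l l≢k → f≈g (suc l) (l≢k ∘ Fin.suc-injective))
           (λ l l≢k → f≈h (suc l) (l≢k ∘ Fin.suc-injective))) ⟩
    f zero * (∏ (g ∘ suc) + u * ∏ (h ∘ suc))
      ≈⟨ distribˡ (f zero) _ _ ⟩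
    f zero * ∏ (g ∘ suc) + f zero * (u * ∏ (h ∘ suc))
      ≈⟨ +-cong (*-congʳ (f≈g zero λ ()))
                (≈-trans (*.x∙yz≈y∙xz (f zero) u _) (*-congˡ (*-congʳ (f≈h zero λ ())))) ⟩
    g zero * ∏ (g ∘ suc) + u * (h zero * ∏ (h ∘ suc)) ∎

  -- The bracket [m > 0] as a ring element. It lets sums run over all letters by killing those terms
  -- in which `pred` is applied to 0.
  positive : ℕ → Carrier
  positive zero    = 0#
  positive (suc _) = 1#

  gaussian : Carrier → ℕ → ℕ → Carrier
  gaussian q a b = ∏ {n = b} λ i →
    (1# - q ^ ((a ∸ b) ℕ.+ suc (toℕ i))) * (1# - q ^ suc (toℕ i)) ⁻¹

  -- The q-Pochhammer symbol of q^(t+1) with m factors: the numerator of a Gaussian coefficient, and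
  -- for t = 0 its denominator.
  rising : Carrier → ℕ → ℕ → Carrier
  rising q t m = ∏ {n = m} λ i → 1# - q ^ (t ℕ.+ suc (toℕ i))

  rising-suc : ∀ q t m → rising q t (suc m) ≈ (1# - q ^ suc t) * rising q (suc t) m
  rising-suc q t m = *-cong (reflexive (cong (λ s → 1# - q ^ s) (ℕ.+-comm t 1)))
    (∏-cong {m} λ i → reflexive (cong (λ s → 1# - q ^ s) (ℕ.+-suc t (suc (toℕ i)))))

  rising-last : ∀ q t m → rising q t (suc m) ≈ rising q t m * (1# - q ^ (t ℕ.+ suc m))
  rising-last q t m = ≈-trans (∏-init-last {m} λ i → 1# - q ^ (t ℕ.+ suc (toℕ i))) (*-cong
    (∏-cong {m} λ i → reflexive (cong (λ s → 1# - q ^ (t ℕ.+ suc s)) (Fin.toℕ-inject₁ i)))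
    (reflexive (cong (λ s → 1# - q ^ (t ℕ.+ suc s)) (Fin.toℕ-fromℕ m))))

  rising-unital : ∀ {q} → Small q → ∀ t m → Unital (rising q t m)
  rising-unital {q} q-small t m = ∏-unital {m} _ λ i →
    subst (λ s → Unital (1# - q ^ s)) (sym (ℕ.+-suc t (toℕ i))) (1-small (small-^ q-small (t ℕ.+ toℕ i)))

  -- Clears denominators: identities between Gaussian coefficients become identities between finite
  -- products, after which the unital factor is cancelled.
  rising*gaussian : ∀ {q} → Small q → ∀ t m → rising q 0 m * gaussian q (t ℕ.+ m) m ≈ rising q t m
  rising*gaussian {q} q-small t m = begin
    rising q 0 m * gaussian q (t ℕ.+ m) m
      ≈⟨ ∏-distrib-* {m} _ _ ⟨
    ∏ {m} (λ i → (1# - q ^ suc (toℕ i)) *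
      ((1# - q ^ ((t ℕ.+ m ∸ m) ℕ.+ suc (toℕ i))) * (1# - q ^ suc (toℕ i)) ⁻¹))
      ≈⟨ ∏-cong {m} (λ i → *-÷-cancel (1-small (small-^ q-small (toℕ i))) _) ⟩
    rising q (t ℕ.+ m ∸ m) m
      ≈⟨ reflexive (cong (λ s → rising q s m) (ℕ.m+n∸n≡m t m)) ⟩
    rising q t m ∎

  -- The generating function of multisets of m numbers, all of them less than t.
  multisets : Carrier → ℕ → ℕ → Carrier
  multisets q m       (suc t) = gaussian q (t ℕ.+ m) m
  multisets q zero    zero    = 1#
  multisets q (suc m) zero    = 0#

  multisets-0 : ∀ q t → multisets q 0 t ≈ 1#
  multisets-0 q zero    = ≈-refl
  multisets-0 q (suc t) = ≈-refl

  multisets-1 : ∀ {q} → Small q → ∀ m → multisets q m 1 ≈ 1#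
  multisets-1 {q} q-small zero    = ≈-refl
  multisets-1 {q} q-small (suc m) = *-cancelˡ (rising-unital q-small 0 (suc m))
    (≈-trans (rising*gaussian q-small 0 (suc m)) (≈-sym (*-identityʳ _)))

  -- The terms distinguish whether the number t occurs.
  pascal : ∀ {q} → Small q → ∀ m t →
    multisets q m (suc t) ≈ multisets q m t + positive m * q ^ t * multisets q (pred m) (suc t)
  pascal {q} q-small zero t = begin
    1#                             ≈⟨ +-identityʳ 1# ⟨
    1# + 0#                        ≈⟨ +-cong (multisets-0 q t) (≈-trans (*-identityʳ _) (zeroˡ (q ^ t))) ⟨
    multisets q 0 t + 0# * q ^ t * 1#  ∎
  pascal {q} q-small (suc m) zero = begin
    multisets q (suc m) 1               ≈⟨ multisets-1 q-small (suc m) ⟩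
    1#                                  ≈⟨ multisets-1 q-small m ⟨
    multisets q m 1                     ≈⟨ *-identityˡ _ ⟨
    1# * multisets q m 1                ≈⟨ *-congʳ (*-identityˡ 1#) ⟨
    1# * 1# * multisets q m 1           ≈⟨ +-identityˡ _ ⟨
    0# + 1# * 1# * multisets q m 1      ∎
  pascal {q} q-small (suc m) (suc t) = *-cancelˡ (rising-unital q-small 0 (suc m)) (begin
    D * gaussian q (suc t ℕ.+ suc m) (suc m)
      ≈⟨ rising*gaussian q-small (suc t) (suc m) ⟩
    rising q (suc t) (suc m)
      ≈⟨ rising-last q (suc t) m ⟩
    r * (1# - q ^ (suc t ℕ.+ suc m))
      -- 1 - ab = (1 - a) + a (1 - b). The factor 1 - a extends `r` to `rising q t (suc m)`, and 1 -
      -- b extends the denominator `rising q 0 m` to `D`.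
      ≈⟨ *-congˡ split ⟩
    r * (1# - a + a * (1# - b))
      ≈⟨ solve 4 (λ r a A B → r :* (A :+ a :* B) := A :* r :+ a :* (r :* B)) ≈-refl r a (1# - a) (1# - b) ⟩
    (1# - a) * r + a * (r * (1# - b))
      ≈⟨ +-cong (rising-suc q t m) (*-congˡ (*-congʳ (rising*gaussian q-small (suc t) m))) ⟨
    rising q t (suc m) + a * (rising q 0 m * g * (1# - b))
      ≈⟨ +-cong (rising*gaussian q-small t (suc m)) (*-congˡ (≈-trans (*-congʳ (rising-last q 0 m)) (*.xy∙z≈xz∙y (rising q 0 m) (1# - b) g))) ⟨
    D * gaussian q (t ℕ.+ suc m) (suc m) + a * (D * g)
      ≈⟨ +-congˡ (≈-trans (*-congˡ (*-congʳ (*-identityˡ a))) (*.x∙yz≈y∙xz D a g)) ⟨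
    D * gaussian q (t ℕ.+ suc m) (suc m) + D * (1# * a * g)
      ≈⟨ distribˡ D _ _ ⟨
    D * (gaussian q (t ℕ.+ suc m) (suc m) + 1# * a * g) ∎)
    where
    a b r g D : Carrier
    a = q ^ suc t
    b = q ^ suc m
    r = rising q (suc t) m
    g = gaussian q (suc t ℕ.+ m) m
    D = rising q 0 (suc m)
    split : 1# - q ^ (suc t ℕ.+ suc m) ≈ 1# - a + a * (1# - b)
    split = ≈-sym (x+y≈z⇒x≈z-y (begin
      1# - a + a * (1# - b) + q ^ (suc t ℕ.+ suc m)
        ≈⟨ +-congˡ (^-homo-* q (suc t) (suc m)) ⟩
      1# - a + a * (1# - b) + a * b
        ≈⟨ +-assoc _ _ _ ⟩
      1# - a + (a * (1# - b) + a * b)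
        ≈⟨ +-congˡ (distribˡ a (1# - b) b) ⟨
      1# - a + a * (1# - b + b)
        ≈⟨ +-congˡ (≈-trans (*-congˡ (x-y+y≈x 1# b)) (*-identityʳ a)) ⟩
      1# - a + a
        ≈⟨ x-y+y≈x 1# a ⟩
      1# ∎))

-- Families of multisets and the recursion of their generating functions.

<ᵇ-true : ∀ {m n} → m ℕ.< n → (m <ᵇ n) ≡ true
<ᵇ-true {m} {n} m<n = dec-true (m ℕ.<? n) m<n

<ᵇ-false : ∀ {m n} → n ℕ.≤ m → (m <ᵇ n) ≡ false
<ᵇ-false {m} {n} n≤m = dec-false (m ℕ.<? n) (ℕ.≤⇒≯ n≤m)

<ᵇ-suc : ∀ {n} (l k : Fin n) → l ≢ k → (toℕ l <ᵇ suc (toℕ k)) ≡ (toℕ l <ᵇ toℕ k)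
<ᵇ-suc zero    zero    l≢k = contradiction refl l≢k
<ᵇ-suc zero    (suc k) l≢k = refl
<ᵇ-suc (suc l) zero    l≢k = refl
<ᵇ-suc (suc l) (suc k) l≢k = <ᵇ-suc l k (l≢k ∘ cong suc)

infixl 6 _∖_
_∖_ : ∀ {n} → Vec ℕ n → Fin n → Vec ℕ n
mult ∖ k = updateAt mult k pred

lookup≡0 : ∀ {n} (mult : Vec ℕ n) → Vec.sum mult ≡ 0 → ∀ l → lookup mult l ≡ 0
lookup≡0 (zero ∷ mult) eq zero    = refl
lookup≡0 (zero ∷ mult) eq (suc l) = lookup≡0 mult eq l

module Multisets (G : SeriesRing) {n : ℕ} (z : Fin n → SeriesRing.Carrier G)
                 (z-small : ∀ k → SeriesRing.Small G (z k)) where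
  open SeriesRing G
  open SeriesRingProperties G
  open SetoidReasoning setoid

  -- Families of multisets, the k-th one consisting of mult k numbers that are
  -- at most t, and less than t if k < κ.  Sorted decreasingly by number and
  -- then increasingly by k, these are the sequences that start from (t , κ) on.
  families : Vec ℕ n → ℕ → ℕ → Carrier
  families mult κ t = ∏ {n} λ l → multisets (z l) (lookup mult l) (if toℕ l <ᵇ κ then t else suc t)

  families-step : ∀ mult k t → families mult (toℕ k) t ≈
    families mult (suc (toℕ k)) t +
    positive (lookup mult k) * z k ^ t * families (mult ∖ k) (toℕ k) t
  families-step mult k t = ∏-step k _ _ _ _ at-k
    (λ l l≢k → reflexive (cong (λ b → multisets (z l) (lookup mult l) (if b then t else suc t))
      (sym (<ᵇ-suc l k l≢k))))
    (λ l l≢k → reflexive (cong (λ m → multisets (z l) m (if toℕ l <ᵇ toℕ k then t else suc t))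
      (sym (Vec.lookup∘updateAt′ l k l≢k mult))))
    where
    at-k : multisets (z k) (lookup mult k) (if toℕ k <ᵇ toℕ k then t else suc t) ≈
           multisets (z k) (lookup mult k) (if toℕ k <ᵇ suc (toℕ k) then t else suc t) +
           positive (lookup mult k) * z k ^ t *
             multisets (z k) (lookup (mult ∖ k) k) (if toℕ k <ᵇ toℕ k then t else suc t)
    at-k rewrite <ᵇ-false (ℕ.≤-refl {toℕ k}) | <ᵇ-true (ℕ.n<1+n (toℕ k)) | Vec.lookup∘updateAt k {pred} mult =
      pascal (z-small k) (lookup mult k) t

  families-n-suc : ∀ mult t → families mult n (suc t) ≈ families mult 0 t
  families-n-suc mult t = ∏-cong {n} λ l → reflexive
    (cong (λ b → multisets (z l) (lookup mult l) (if b then suc t else suc (suc t))) (<ᵇ-true (Fin.toℕ<n l)))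

  -- Some multiset is nonempty, yet its numbers would have to be less than 0. The vanishing term at
  -- t = 0 is what leaves `familySeries-n` without a correction term.
  families-n-0 : ∀ mult {M} → Vec.sum mult ≡ suc M → families mult n 0 ≈ 0#
  families-n-0 mult sum≡ = ≈-trans
    (∏-cong {n} λ l → reflexive
      (cong (λ b → multisets (z l) (lookup mult l) (if b then 0 else 1)) (<ᵇ-true (Fin.toℕ<n l))))
    (vanish z mult sum≡)
    where
    vanish : ∀ {n} (z : Fin n → Carrier) mult {M} → Vec.sum mult ≡ suc M →
             ∏ {n} (λ l → multisets (z l) (lookup mult l) 0) ≈ 0#
    vanish z (zero  ∷ mult) sum≡ = ≈-trans (*-congˡ (vanish (z ∘ suc) mult sum≡)) (zeroʳ _)
    vanish z (suc _ ∷ mult) sum≡ = zeroˡ _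

  familySeries : Vec ℕ n → ℕ → Carrier → Carrier
  familySeries mult κ x = series x (families mult κ)

  -- The power of z_k in the Pascal term is absorbed by the series variable, as xᵗ z_kᵗ = (x z_k)ᵗ:
  -- the prefix product has grown by the letter `k`. The case split takes `positive` out of the
  -- series.
  familySeries-step : ∀ mult k x → familySeries mult (toℕ k) x ≈
    familySeries mult (suc (toℕ k)) x +
    positive (lookup mult k) * familySeries (mult ∖ k) (toℕ k) (x * z k)
  familySeries-step mult k x with lookup mult k | families-step mult k
  ... | zero  | step = begin
    familySeries mult (toℕ k) x
      ≈⟨ series-cong (λ t → *-congˡ (≈-trans (step t)
           (≈-trans (+-congˡ (≈-trans (*-congʳ (zeroˡ _)) (zeroˡ _))) (+-identityʳ _)))) ⟩
    familySeries mult (suc (toℕ k)) x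
      ≈⟨ +-identityʳ _ ⟨
    familySeries mult (suc (toℕ k)) x + 0#
      ≈⟨ +-congˡ (zeroˡ _) ⟨
    familySeries mult (suc (toℕ k)) x + 0# * familySeries (mult ∖ k) (toℕ k) (x * z k) ∎
  ... | suc _ | step = begin
    familySeries mult (toℕ k) x
      ≈⟨ series-cong (λ t → *-congˡ (step t)) ⟩
    series x (λ t → families mult (suc (toℕ k)) t + 1# * z k ^ t * families (mult ∖ k) (toℕ k) t)
      ≈⟨ series-+ x _ _ ⟩
    familySeries mult (suc (toℕ k)) x + series x (λ t → 1# * z k ^ t * families (mult ∖ k) (toℕ k) t)
      ≈⟨ +-congˡ (series-cong λ t → ≈-trans (*-congˡ (*-congʳ (*-identityˡ _)))
           (≈-trans (≈-sym (*-assoc _ _ _)) (*-congʳ (≈-sym (^-distrib-* x (z k) t))))) ⟩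
    familySeries mult (suc (toℕ k)) x + familySeries (mult ∖ k) (toℕ k) (x * z k)
      ≈⟨ +-congˡ (*-identityˡ _) ⟨
    familySeries mult (suc (toℕ k)) x + 1# * familySeries (mult ∖ k) (toℕ k) (x * z k) ∎

  familySeries-n : ∀ mult {M} → Vec.sum mult ≡ suc M → ∀ {x} → Small x →
    familySeries mult n x ≈ x * familySeries mult 0 x
  familySeries-n mult sum≡ {x} x-small = begin
    familySeries mult n x
      ≈⟨ series-suc x-small _ ⟩
    families mult n 0 + x * series x (λ t → families mult n (suc t))
      ≈⟨ +-cong (families-n-0 mult sum≡) (*-congˡ (series-cong λ t → *-congˡ (families-n-suc mult t))) ⟩
    0# + x * familySeries mult 0 x
      ≈⟨ +-identityˡ _ ⟩
    x * familySeries mult 0 x ∎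

  familySeries-empty : ∀ mult → Vec.sum mult ≡ 0 → ∀ κ {x} → Small x →
    familySeries mult κ x ≈ (1# - x) ⁻¹
  familySeries-empty mult sum≡0 κ {x} x-small = begin
    familySeries mult κ x  ≈⟨ series-cong (λ t → *-congˡ (families≈1 t)) ⟩
    series x (λ _ → 1#)    ≈⟨ *-unique (1-small x-small) (fixpoint⇒[1-x]u≈a (series-suc x-small _)) ⟩
    1# * (1# - x) ⁻¹       ≈⟨ *-identityˡ _ ⟩
    (1# - x) ⁻¹            ∎
    where
    families≈1 : ∀ t → families mult κ t ≈ 1#
    families≈1 t = ≈-trans
      (∏-cong {n} λ l → ≈-trans
        (reflexive (cong (λ m → multisets (z l) m (if toℕ l <ᵇ κ then t else suc t)) (lookup≡0 mult sum≡0 l)))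
        (multisets-0 (z l) (if toℕ l <ᵇ κ then t else suc t)))
      (∏-1 n)

  descentFactor : ℕ → Carrier → Fin n → Carrier
  descentFactor κ x l = if toℕ l <ᵇ κ then x else 1#

  -- With S and R as below, the R l with l ≥ κ add up to S κ - S n, and those with l < κ to S 0 - S
  -- κ. Weighting the latter by x and inserting S n = x S 0 leaves (1 - x) S κ.
  familySeries-rec : ∀ mult {M} → Vec.sum mult ≡ suc M → ∀ {κ} → κ ℕ.≤ n → ∀ {x} → Small x →
    familySeries mult κ x ≈
    sum (λ l → positive (lookup mult l) *
      (descentFactor κ x l * (1# - x) ⁻¹ * familySeries (mult ∖ l) (toℕ l) (x * z l)))
  familySeries-rec mult sum≡ {κ} κ≤n {x} x-small = begin
    familySeries mult κ x
      ≈⟨ *-unique (1-small x-small) (fixpoint⇒[1-x]u≈a (+-cancelʳ (familySeries mult n x) _ _ (begin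
           S κ + S n                        ≈⟨ +-comm (S κ) (S n) ⟩
           S n + S κ                        ≈⟨ +-congʳ (familySeries-n mult sum≡ x-small) ⟩
           x * S 0 + S κ                    ≈⟨ telescope S R (λ k → familySeries-step mult k x) κ≤n ⟨
           sum {n} (λ l → descentFactor κ x l * R l) + (x * S κ + S n)
                                            ≈⟨ +-assoc _ _ _ ⟨
           sum {n} (λ l → descentFactor κ x l * R l) + x * S κ + S n ∎))) ⟩
    sum (λ l → descentFactor κ x l * R l) * (1# - x) ⁻¹
      ≈⟨ *-distribʳ-sum {n} _ _ ⟩
    sum (λ l → descentFactor κ x l * R l * (1# - x) ⁻¹)
      ≈⟨ sum-cong {n} (λ l → solve 4 (λ w p s v → w :* (p :* s) :* v := p :* (w :* v :* s)) ≈-refl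
           (descentFactor κ x l) (positive (lookup mult l)) (familySeries (mult ∖ l) (toℕ l) (x * z l)) ((1# - x) ⁻¹)) ⟩
    sum (λ l → positive (lookup mult l) *
      (descentFactor κ x l * (1# - x) ⁻¹ * familySeries (mult ∖ l) (toℕ l) (x * z l))) ∎
    where
    open Solver using (solve; _:+_; _:*_; _:=_)
    S : ℕ → Carrier
    S κ = familySeries mult κ x
    R : Fin n → Carrier
    R l = positive (lookup mult l) * familySeries (mult ∖ l) (toℕ l) (x * z l)

    telescope₀ : ∀ {n} (S : ℕ → Carrier) (R : Fin n → Carrier) →
      (∀ k → S (toℕ k) ≈ S (suc (toℕ k)) + R k) →
      sum {n} (λ l → 1# * R l) + S n ≈ S 0
    telescope₀ {zero}  S R step = +-identityˡ _
    telescope₀ {suc n} S R step = begin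
      1# * R zero + sum {n} (λ l → 1# * R (suc l)) + S (suc n)
        ≈⟨ +-assoc _ _ _ ⟩
      1# * R zero + (sum {n} (λ l → 1# * R (suc l)) + S (suc n))
        ≈⟨ +-cong (*-identityˡ _) (telescope₀ (S ∘ suc) (R ∘ suc) (step ∘ suc)) ⟩
      R zero + S 1
        ≈⟨ +-comm _ _ ⟩
      S 1 + R zero
        ≈⟨ step zero ⟨
      S 0 ∎

    -- All differences are moved to the other side, so that only semiring laws are used; `S` and `R`
    -- are arbitrary so that the induction can shift them by one letter.
    telescope : ∀ {n} (S : ℕ → Carrier) (R : Fin n → Carrier) →
      (∀ k → S (toℕ k) ≈ S (suc (toℕ k)) + R k) → ∀ {κ} → κ ℕ.≤ n →
      sum {n} (λ l → (if toℕ l <ᵇ κ then x else 1#) * R l) + (x * S κ + S n) ≈ x * S 0 + S κ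
    telescope {n} S R step {zero} ℕ.z≤n = begin
      sum {n} (λ l → 1# * R l) + (x * S 0 + S n)
        ≈⟨ solve 3 (λ a b c → a :+ (b :+ c) := b :+ (a :+ c)) ≈-refl (sum {n} (λ l → 1# * R l)) (x * S 0) (S n) ⟩
      x * S 0 + (sum {n} (λ l → 1# * R l) + S n)
        ≈⟨ +-congˡ (telescope₀ S R step) ⟩
      x * S 0 + S 0 ∎
    telescope {suc n} S R step {suc κ} (ℕ.s≤s κ≤n) = begin
      x * R zero + sum {n} rest + (x * S (suc κ) + S (suc n))
        ≈⟨ +-assoc _ _ _ ⟩
      x * R zero + (sum {n} rest + (x * S (suc κ) + S (suc n)))
        ≈⟨ +-congˡ (telescope (S ∘ suc) (R ∘ suc) (step ∘ suc) κ≤n) ⟩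
      x * R zero + (x * S 1 + S (suc κ))
        ≈⟨ solve 4 (λ x r s t → x :* r :+ (x :* s :+ t) := x :* (s :+ r) :+ t) ≈-refl x (R zero) (S 1) (S (suc κ)) ⟩
      x * (S 1 + R zero) + S (suc κ)
        ≈⟨ +-congʳ (*-congˡ (step zero)) ⟨
      x * S 0 + S (suc κ) ∎
      where
      rest : Fin n → Carrier
      rest l = (if toℕ l <ᵇ κ then x else 1#) * R (suc l)

-- Colour changes as residues, and geometric sums over them.

[m+j]-m%ℕ : ∀ d j s .{{_ : NonZero (d ℕ.+ s)}} → j ℕ.< s →
  (ℤ.+ suc (d ℕ.+ j) ℤ.- ℤ.+ suc d) %ℕ (d ℕ.+ s) ≡ j
[m+j]-m%ℕ d j s j<s = trans
  (cong (_%ℕ (d ℕ.+ s)) (begin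
    ℤ.+ suc (d ℕ.+ j) ℤ.- ℤ.+ suc d  ≡⟨ ℤ.[+m]-[+n]≡m⊖n (suc (d ℕ.+ j)) (suc d) ⟩
    suc (d ℕ.+ j) ℤ.⊖ suc d          ≡⟨ ℤ.⊖-≥ (ℕ.s≤s (ℕ.m≤m+n d j)) ⟩
    ℤ.+ (d ℕ.+ j ∸ d)                ≡⟨ cong ℤ.+_ (ℕ.m+n∸m≡n d j) ⟩
    ℤ.+ j                            ∎))
  (ℕ.m<n⇒m%n≡m (ℕ.<-≤-trans j<s (ℕ.m≤n+m s d)))
  where open ≡-Reasoning

-[1+p]%ℕ : ∀ p r .{{_ : NonZero r}} → suc p ℕ.< r → -[1+ p ] %ℕ r ≡ r ∸ suc p
-[1+p]%ℕ p r p<r rewrite ℕ.m<n⇒m%n≡m p<r = refl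

-- The colours below that of the successor wrap around: with d = c + 1 + p and r = d + s, the
-- residue is r - (p + 1) = s + c. The remaining colours give 0,...,s-1, so all residues occur once.
c-[c+1+p]%ℕ : ∀ c p s .{{_ : NonZero (suc c ℕ.+ p ℕ.+ s)}} → 0 ℕ.< s →
  (ℤ.+ suc c ℤ.- ℤ.+ suc (suc c ℕ.+ p)) %ℕ (suc c ℕ.+ p ℕ.+ s) ≡ s ℕ.+ c
c-[c+1+p]%ℕ c p s 0<s = begin
  (ℤ.+ suc c ℤ.- ℤ.+ suc (suc c ℕ.+ p)) %ℕ (suc c ℕ.+ p ℕ.+ s)
    ≡⟨ cong (_%ℕ (suc c ℕ.+ p ℕ.+ s)) negative ⟩
  -[1+ p ] %ℕ (suc c ℕ.+ p ℕ.+ s)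
    ≡⟨ -[1+p]%ℕ p _ p<r ⟩
  suc c ℕ.+ p ℕ.+ s ∸ suc p
    ≡⟨ cong (_∸ suc p) total ⟩
  s ℕ.+ c ℕ.+ suc p ∸ suc p
    ≡⟨ ℕ.m+n∸n≡m (s ℕ.+ c) (suc p) ⟩
  s ℕ.+ c ∎
  where
  open ≡-Reasoning
  total : suc c ℕ.+ p ℕ.+ s ≡ s ℕ.+ c ℕ.+ suc p
  total = trans (ℕ.+-comm (suc c ℕ.+ p) s)
    (trans (cong (s ℕ.+_) (sym (ℕ.+-suc c p))) (sym (ℕ.+-assoc s c (suc p))))
  p<r : suc p ℕ.< suc c ℕ.+ p ℕ.+ s
  p<r = subst (suc p ℕ.<_) (sym total)
    (ℕ.+-monoˡ-≤ (suc p) (ℕ.≤-trans 0<s (ℕ.m≤m+n s c)))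
  negative : ℤ.+ suc c ℤ.- ℤ.+ suc (suc c ℕ.+ p) ≡ -[1+ p ]
  negative = trans (ℤ.[+m]-[+n]≡m⊖n (suc c) (suc (suc c ℕ.+ p)))
    (trans (ℤ.⊖-< (ℕ.s≤s (ℕ.m≤m+n (suc c) p)))
      (cong (λ m → ℤ.- ℤ.+ m) (trans (cong (_∸ c) (sym (ℕ.+-suc c p))) (ℕ.m+n∸m≡n c (suc p)))))

module CyclicSums (G : SeriesRing) where
  open SeriesRing G
  open SeriesRingProperties G
  open SetoidReasoning setoid

  Σ< : ℕ → (ℕ → Carrier) → Carrier
  Σ< m F = sum {m} (λ i → F (toℕ i))

  Σ<-cong : ∀ m {F G} → (∀ i → i ℕ.< m → F i ≈ G i) → Σ< m F ≈ Σ< m G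
  Σ<-cong m eq = sum-cong {m} λ i → eq (toℕ i) (Fin.toℕ<n i)

  Σ<-+ : ∀ a b F → Σ< (a ℕ.+ b) F ≈ Σ< a F + Σ< b (λ j → F (a ℕ.+ j))
  Σ<-+ zero    b F = ≈-sym (+-identityˡ _)
  Σ<-+ (suc a) b F = ≈-trans (+-congˡ (Σ<-+ a b (F ∘ suc))) (≈-sym (+-assoc _ _ _))

  Σ<-rotate : ∀ d s (g : ℕ → ℕ) F → (∀ c → c ℕ.< d → g c ≡ s ℕ.+ c) → (∀ j → j ℕ.< s → g (d ℕ.+ j) ≡ j) →
    Σ< (d ℕ.+ s) (F ∘ g) ≈ Σ< (d ℕ.+ s) F
  Σ<-rotate d s g F low high = begin
    Σ< (d ℕ.+ s) (F ∘ g)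
      ≈⟨ Σ<-+ d s (F ∘ g) ⟩
    Σ< d (F ∘ g) + Σ< s (λ j → F (g (d ℕ.+ j)))
      ≈⟨ +-cong (Σ<-cong d λ c c<d → reflexive (cong F (low c c<d)))
                (Σ<-cong s λ j j<s → reflexive (cong F (high j j<s))) ⟩
    Σ< d (λ c → F (s ℕ.+ c)) + Σ< s F
      ≈⟨ +-comm _ _ ⟩
    Σ< s F + Σ< d (λ c → F (s ℕ.+ c))
      ≈⟨ Σ<-+ s d F ⟨
    Σ< (s ℕ.+ d) F
      ≡⟨ cong (λ r → Σ< r F) (ℕ.+-comm s d) ⟩
    Σ< (d ℕ.+ s) F ∎

  Σ<-difference : ∀ r .{{_ : NonZero r}} d → d ℕ.< r → ∀ F →
    Σ< r (λ c → F ((ℤ.+ suc c ℤ.- ℤ.+ suc d) %ℕ r)) ≈ Σ< r F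
  Σ<-difference r d d<r F with ℕ.m≤n⇒∃[o]m+o≡n d<r
  ... | o , refl = subst
    -- The witness yields r = suc d + o, whereas the rotation needs r = d + suc o. The `NonZero`
    -- instance depends on r and so is quantified inside the motive.
    (λ r → .{{_ : NonZero r}} → Σ< r (λ c → F ((ℤ.+ suc c ℤ.- ℤ.+ suc d) %ℕ r)) ≈ Σ< r F)
    (ℕ.+-suc d o)
    (Σ<-rotate d (suc o) _ F
      low
      (λ j j<s → [m+j]-m%ℕ d j (suc o) j<s))
    where
    low : .{{_ : NonZero (d ℕ.+ suc o)}} → ∀ c → c ℕ.< d →
          (ℤ.+ suc c ℤ.- ℤ.+ suc d) %ℕ (d ℕ.+ suc o) ≡ suc o ℕ.+ c
    low c c<d with ℕ.m≤n⇒∃[o]m+o≡n c<d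
    ... | p , refl = c-[c+1+p]%ℕ c p (suc o) (ℕ.s≤s ℕ.z≤n)

  geometric-suc : ∀ x r → Σ< (suc r) (x ^_) ≈ 1# + x * Σ< r (x ^_)
  geometric-suc x r = +-congˡ (≈-sym (*-distribˡ-sum {r} x _))

  -- Both sides are 1 + x + ⋯ + xʳ, with the last or the first term split off.
  geometric-last : ∀ x r → Σ< r (x ^_) + x ^ r ≈ 1# + x * Σ< r (x ^_)
  geometric-last x zero    = ≈-trans (+-comm _ _) (+-congˡ (≈-sym (zeroʳ x)))
  geometric-last x (suc r) = begin
    Σ< (suc r) (x ^_) + x * x ^ r       ≈⟨ +-congʳ (geometric-suc x r) ⟩
    1# + x * Σ< r (x ^_) + x * x ^ r    ≈⟨ +-assoc _ _ _ ⟩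
    1# + (x * Σ< r (x ^_) + x * x ^ r)  ≈⟨ +-congˡ (distribˡ x _ _) ⟨
    1# + x * (Σ< r (x ^_) + x ^ r)      ≈⟨ +-congˡ (*-congˡ (geometric-last x r)) ⟩
    1# + x * (1# + x * Σ< r (x ^_))     ≈⟨ +-congˡ (*-congˡ (geometric-suc x r)) ⟨
    1# + x * Σ< (suc r) (x ^_)          ∎

  geometric-÷ : ∀ {x} → Small x → ∀ r .{{_ : NonZero r}} →
    Σ< r (x ^_) * (1# - x ^ r) ⁻¹ ≈ (1# - x) ⁻¹
  geometric-÷ {x} x-small (suc r) = ≈-sym (*-unique (1-small (small-^ x-small r)) (begin
    (1# - x ^ suc r) * (1# - x) ⁻¹
      ≈⟨ *-congʳ (fixpoint⇒[1-x]u≈a (+-cancelʳ (x ^ suc r) _ _ (begin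
           U + x ^ suc r                         ≈⟨ geometric-last x (suc r) ⟩
           1# + x * U                            ≈⟨ +-congʳ (x-y+y≈x 1# (x ^ suc r)) ⟨
           1# - x ^ suc r + x ^ suc r + x * U    ≈⟨ +-assoc _ _ _ ⟩
           1# - x ^ suc r + (x ^ suc r + x * U)  ≈⟨ +-congˡ (+-comm _ _) ⟩
           1# - x ^ suc r + (x * U + x ^ suc r)  ≈⟨ +-assoc _ _ _ ⟨
           1# - x ^ suc r + x * U + x ^ suc r    ∎))) ⟨
    (1# - x) * U * (1# - x) ⁻¹
      ≈⟨ *-assoc _ _ _ ⟩
    (1# - x) * (U * (1# - x) ⁻¹)
      ≈⟨ *-÷-cancel (1-small x-small) U ⟩
    U ∎))
    where
    U : Carrier
    U = Σ< (suc r) (x ^_)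

  -- For a descent, the term xʳ replaces the term x⁰.
  geometric-descent : ∀ x r .{{_ : NonZero r}} (b : Bool) →
    Σ< r (λ a → x ^ a * (if b ∧ (a ≡ᵇ 0) then x ^ r else 1#)) ≈ (if b then x else 1#) * Σ< r (x ^_)
  geometric-descent x r false = ≈-trans (Σ<-cong r (λ a _ → *-identityʳ (x ^ a))) (≈-sym (*-identityˡ _))
  geometric-descent x (suc r) true = begin
    1# * x ^ suc r + Σ< r (λ a → x ^ suc a * 1#)
      ≈⟨ +-cong (*-identityˡ _) (Σ<-cong r (λ a _ → *-identityʳ (x ^ suc a))) ⟩
    x * x ^ r + Σ< r (λ a → x * x ^ a)
      ≈⟨ +-congˡ (*-distribˡ-sum {r} x _) ⟨
    x * x ^ r + x * Σ< r (x ^_)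
      ≈⟨ +-comm _ _ ⟩
    x * Σ< r (x ^_) + x * x ^ r
      ≈⟨ distribˡ x _ _ ⟨
    x * (Σ< r (x ^_) + x ^ r)
      ≈⟨ *-congˡ (≈-trans (geometric-last x r) (≈-sym (geometric-suc x r))) ⟩
    x * Σ< (suc r) (x ^_) ∎

-- If c < d, the residue is s + c with s = r - d > 0; otherwise it is c - d itself.
difference%≡0⇒≡ : ∀ r .{{_ : NonZero r}} {c d} → c ℕ.< r → d ℕ.< r →
  (ℤ.+ suc c ℤ.- ℤ.+ suc d) %ℕ r ≡ 0 → c ≡ d
difference%≡0⇒≡ r {c} {d} c<r d<r eq with c ℕ.<? d
... | yes c<d with ℕ.m≤n⇒∃[o]m+o≡n c<d | ℕ.m≤n⇒∃[o]m+o≡n (ℕ.<⇒≤ d<r)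
...   | p , refl | s , refl = contradiction
  (ℕ.m+n≡0⇒m≡0 s (trans (sym (c-[c+1+p]%ℕ c p s 0<s)) eq)) (ℕ.>⇒≢ 0<s)
  where
  0<s : 0 ℕ.< s
  0<s = ℕ.+-cancelˡ-< (suc c ℕ.+ p) 0 s (subst (ℕ._< suc c ℕ.+ p ℕ.+ s) (sym (ℕ.+-identityʳ _)) d<r)
difference%≡0⇒≡ r {c} {d} c<r d<r eq | no c≮d
  with ℕ.m≤n⇒∃[o]m+o≡n (ℕ.≮⇒≥ c≮d) | ℕ.m≤n⇒∃[o]m+o≡n (ℕ.<⇒≤ d<r)
... | j , refl | s , refl = trans
  (cong (d ℕ.+_) (trans (sym ([m+j]-m%ℕ d j s (ℕ.+-cancelˡ-< d j s c<r))) eq)) (ℕ.+-identityʳ d)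

-- When the colour change is 0 the colours agree, and the colour ordering compares the letters;
-- otherwise both conjunctions are false.
does-descent : ∀ L K c d a → (a ≡ 0 → c ≡ d) →
  does (((L , suc d) <ᶜ? (K , suc c)) ×-dec (a ℕ.≟ 0)) ≡ (L <ᵇ K) ∧ (a ≡ᵇ 0)
does-descent L K c d (suc a) c≡d = trans (∧-zeroʳ _) (sym (∧-zeroʳ (L <ᵇ K)))
does-descent L K c d zero    c≡d with refl ← c≡d refl
  rewrite <ᵇ-false (ℕ.≤-refl {d}) | dec-true (d ℕ.≟ d) refl = refl

-- Splitting sums over words by the first letter.

hasMultiplicities-∷-zero : ∀ {n r M} (mult : Vec ℕ n) l (d : Fin r) (w : Word n r M) →
  lookup mult l ≡ 0 → does (hasMultiplicities? mult ((l , d) ∷ w)) ≡ false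
hasMultiplicities-∷-zero mult l d w mₗ≡0 = dec-false (hasMultiplicities? mult ((l , d) ∷ w))
  λ has → contradiction (trans (has l) mₗ≡0) count≢0
  where
  count≢0 : Vec.count (l Fin.≟_) (l ∷ Vec.map proj₁ w) ≢ 0
  count≢0 rewrite dec-true (l Fin.≟ l) refl = λ ()

hasMultiplicities-∷-suc : ∀ {n r M} (mult : Vec ℕ n) l (d : Fin r) (w : Word n r M) {m} →
  lookup mult l ≡ suc m →
  does (hasMultiplicities? mult ((l , d) ∷ w)) ≡ does (hasMultiplicities? (mult ∖ l) w)
hasMultiplicities-∷-suc mult l d w {m} mₗ≡1+m =
  does-⇔ (mk⇔ to from) (hasMultiplicities? mult ((l , d) ∷ w)) (hasMultiplicities? (mult ∖ l) w)
  where
  lookup-∖ : lookup (mult ∖ l) l ≡ m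
  lookup-∖ = trans (Vec.lookup∘updateAt l mult) (cong pred mₗ≡1+m)
  to : HasMultiplicities mult ((l , d) ∷ w) → HasMultiplicities (mult ∖ l) w
  to has k with k Fin.≟ l | has k
  ... | yes refl | eq = trans (ℕ.suc-injective (trans eq mₗ≡1+m)) (sym lookup-∖)
  ... | no k≢l   | eq = trans eq (sym (Vec.lookup∘updateAt′ k l k≢l mult))
  from : HasMultiplicities (mult ∖ l) w → HasMultiplicities mult ((l , d) ∷ w)
  from has k with k Fin.≟ l | has k
  ... | yes refl | eq = trans (cong suc (trans eq lookup-∖)) (sym mₗ≡1+m)
  ... | no k≢l   | eq = trans eq (Vec.lookup∘updateAt′ k l k≢l mult)

suc-sum-∖ : ∀ {n} (mult : Vec ℕ n) l {m} → lookup mult l ≡ suc m →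
  suc (Vec.sum (mult ∖ l)) ≡ Vec.sum mult
suc-sum-∖ (suc m ∷ mult) zero    refl = refl
suc-sum-∖ (x ∷ mult)     (suc l) eq   =
  trans (sym (ℕ.+-suc x _)) (cong (x ℕ.+_) (suc-sum-∖ mult l eq))

-- `colouredPermutations` with the length as a separate parameter, since deleting a letter lowers
-- the sum of the multiplicities only up to a propositional equality.
words : ∀ {n} (r : ℕ) → Vec ℕ n → (M : ℕ) → List (Word n r M)
words {n} r mult M =
  List.filter (hasMultiplicities? mult) (vecsOver (cartesianProduct (allFin n) (allFin r)) M)

module ListSums (G : SeriesRing) where
  open SeriesRing G
  open SeriesRingProperties G
  open SetoidReasoning setoid
  private variable A B C : Set

  Σˡ : List A → (A → Carrier) → Carrier
  Σˡ xs f = List.foldr (λ x s → f x + s) 0# xs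

  Σˡ-cong : ∀ (xs : List A) {f g} → (∀ x → f x ≈ g x) → Σˡ xs f ≈ Σˡ xs g
  Σˡ-cong []       f≈g = ≈-refl
  Σˡ-cong (x ∷ xs) f≈g = +-cong (f≈g x) (Σˡ-cong xs f≈g)

  Σˡ-++ : ∀ (xs ys : List A) f → Σˡ (xs List.++ ys) f ≈ Σˡ xs f + Σˡ ys f
  Σˡ-++ []       ys f = ≈-sym (+-identityˡ _)
  Σˡ-++ (x ∷ xs) ys f = ≈-trans (+-congˡ (Σˡ-++ xs ys f)) (≈-sym (+-assoc _ _ _))

  Σˡ-map : ∀ (g : A → B) xs f → Σˡ (List.map g xs) f ≈ Σˡ xs (f ∘ g)
  Σˡ-map g []       f = ≈-refl
  Σˡ-map g (x ∷ xs) f = +-congˡ (Σˡ-map g xs f)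

  Σˡ-cartesianProductWith : ∀ (g : A → B → C) xs ys f →
    Σˡ (cartesianProductWith g xs ys) f ≈ Σˡ xs (λ x → Σˡ ys (λ y → f (g x y)))
  Σˡ-cartesianProductWith g []       ys f = ≈-refl
  Σˡ-cartesianProductWith g (x ∷ xs) ys f = ≈-trans (Σˡ-++ (List.map (g x) ys) _ f)
    (+-cong (Σˡ-map (g x) ys f) (Σˡ-cartesianProductWith g xs ys f))

  Σˡ-tabulate : ∀ {n} (g : Fin n → A) f → Σˡ (List.tabulate g) f ≈ sum (λ i → f (g i))
  Σˡ-tabulate {n = zero}  g f = ≈-refl
  Σˡ-tabulate {n = suc n} g f = +-congˡ (Σˡ-tabulate (g ∘ suc) f)

  indicator : Bool → Carrier
  indicator b = if b then 1# else 0#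

  -- Trades the filter for a weight, so that the sum over all words becomes an iterated sum over
  -- first letter, colour and tail.
  Σˡ-filter : ∀ {P : A → Set} (P? : ∀ x → Dec (P x)) xs f →
    Σˡ (List.filter P? xs) f ≈ Σˡ xs (λ x → indicator (does (P? x)) * f x)
  Σˡ-filter P? []       f = ≈-refl
  Σˡ-filter P? (x ∷ xs) f with does (P? x)
  ... | true  = +-cong (≈-sym (*-identityˡ _)) (Σˡ-filter P? xs f)
  ... | false = ≈-trans (Σˡ-filter P? xs f) (≈-sym (≈-trans (+-congʳ (zeroˡ _)) (+-identityˡ _)))

  *-distribˡ-Σˡ : ∀ a (xs : List A) f → a * Σˡ xs f ≈ Σˡ xs (λ x → a * f x)
  *-distribˡ-Σˡ a []       f = zeroʳ a
  *-distribˡ-Σˡ a (x ∷ xs) f = ≈-trans (distribˡ a _ _) (+-congˡ (*-distribˡ-Σˡ a xs f))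

  sum-Σˡ-comm : ∀ {n} (xs : List A) (f : Fin n → A → Carrier) →
    sum (λ i → Σˡ xs (f i)) ≈ Σˡ xs (λ x → sum (λ i → f i x))
  sum-Σˡ-comm {n = n} []       f = sum-0 n
  sum-Σˡ-comm {n = n} (x ∷ xs) f = ≈-trans (sum-distrib-+ {n} _ _) (+-congˡ (sum-Σˡ-comm xs f))

  -- A word beginning with `l` has multiplicities `mult` exactly when `l` is available there and the
  -- tail has multiplicities `mult ∖ l`.
  Σˡ-words-suc : ∀ {n r M} (mult : Vec ℕ n) (f : Word n r (suc M) → Carrier) →
    Σˡ (words r mult (suc M)) f ≈
    sum (λ l → positive (lookup mult l) * sum (λ d → Σˡ (words r (mult ∖ l) M) (λ w → f ((l , d) ∷ w))))
  Σˡ-words-suc {n} {r} {M} mult f = begin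
    Σˡ (words r mult (suc M)) f
      ≈⟨ Σˡ-filter (hasMultiplicities? mult) (vecsOver letters (suc M)) f ⟩
    Σˡ (vecsOver letters (suc M)) (λ w → indicator (does (hasMultiplicities? mult w)) * f w)
      ≈⟨ Σˡ-cartesianProductWith _∷_ letters (vecsOver letters M) _ ⟩
    Σˡ letters (λ p → Σˡ (vecsOver letters M) (λ w → g p w))
      ≈⟨ Σˡ-cartesianProductWith _,_ (allFin n) (allFin r) _ ⟩
    Σˡ (allFin n) (λ l → Σˡ (allFin r) (λ d → Σˡ (vecsOver letters M) (g (l , d))))
      ≈⟨ Σˡ-tabulate {n = n} id _ ⟩
    sum (λ l → Σˡ (allFin r) (λ d → Σˡ (vecsOver letters M) (g (l , d))))
      ≈⟨ sum-cong {n} (λ l → ≈-trans (Σˡ-tabulate {n = r} id _)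
           (≈-trans (sum-cong {r} (λ d → letter l d)) (≈-sym (*-distribˡ-sum {r} _ _)))) ⟩
    sum (λ l → positive (lookup mult l) * sum (λ d → Σˡ (words r (mult ∖ l) M) (λ w → f ((l , d) ∷ w)))) ∎
    where
    letters : List (Fin n × Fin r)
    letters = cartesianProduct (allFin n) (allFin r)
    g : Fin n × Fin r → Word n r M → Carrier
    g p w = indicator (does (hasMultiplicities? mult (p ∷ w))) * f (p ∷ w)
    indicator-∷ : ∀ l d w → indicator (does (hasMultiplicities? mult ((l , d) ∷ w))) ≈
      positive (lookup mult l) * indicator (does (hasMultiplicities? (mult ∖ l) w))
    indicator-∷ l d w with lookup mult l in eq
    ... | zero  = ≈-trans (reflexive (cong indicator (hasMultiplicities-∷-zero mult l d w eq))) (≈-sym (zeroˡ _))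
    ... | suc _ = ≈-trans (reflexive (cong indicator (hasMultiplicities-∷-suc mult l d w eq))) (≈-sym (*-identityˡ _))
    letter : ∀ l d → Σˡ (vecsOver letters M) (g (l , d)) ≈
      positive (lookup mult l) * Σˡ (words r (mult ∖ l) M) (λ w → f ((l , d) ∷ w))
    letter l d = begin
      Σˡ (vecsOver letters M) (g (l , d))
        ≈⟨ Σˡ-cong (vecsOver letters M) (λ w → ≈-trans (*-congʳ (indicator-∷ l d w)) (*-assoc _ _ _)) ⟩
      Σˡ (vecsOver letters M) (λ w → positive (lookup mult l) *
        (indicator (does (hasMultiplicities? (mult ∖ l) w)) * f ((l , d) ∷ w)))
        ≈⟨ *-distribˡ-Σˡ _ (vecsOver letters M) _ ⟨
      positive (lookup mult l) * Σˡ (vecsOver letters M) (λ w →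
        indicator (does (hasMultiplicities? (mult ∖ l) w)) * f ((l , d) ∷ w))
        ≈⟨ *-congˡ (Σˡ-filter (hasMultiplicities? (mult ∖ l)) (vecsOver letters M) _) ⟨
      positive (lookup mult l) * Σˡ (words r (mult ∖ l) M) (λ w → f ((l , d) ∷ w)) ∎

-- The sum over coloured words, by induction on the length.

module WordSums (G : SeriesRing) {n : ℕ} (z : Fin n → SeriesRing.Carrier G)
                (z-small : ∀ k → SeriesRing.Small G (z k)) (r : ℕ) .{{_ : NonZero r}} where
  open SeriesRing G
  open SeriesRingProperties G
  open CyclicSums G
  open ListSums G
  open Multisets G z z-small
  open SetoidReasoning setoid

  difference : ColouredLetter → ColouredLetter → ℕ
  difference p q = (ℤ.+ proj₂ p ℤ.- ℤ.+ proj₂ q) %ℕ r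

  descentPower : ColouredLetter → ColouredLetter → Carrier → Carrier
  descentPower p q x = if does ((q <ᶜ? p) ×-dec (difference p q ℕ.≟ 0)) then x ^ r else 1#

  -- The share of one position in the summand: `p` is the letter there, `q` its successor, `x` its
  -- prefix product.
  factor : ColouredLetter → ColouredLetter → Carrier → Carrier
  factor p q x = x ^ difference p q * descentPower p q x * (1# - x ^ r) ⁻¹

  factor-cong : ∀ p q {x y} → x ≈ y → factor p q x ≈ factor p q y
  factor-cong p q x≈y = *-cong
    (*-cong (^-congˡ (difference p q) x≈y) (descentPower-cong (does ((q <ᶜ? p) ×-dec (difference p q ℕ.≟ 0)))))
    (⁻¹-cong (+-congˡ (-‿cong (^-congˡ r x≈y))))
    where
    descentPower-cong : ∀ b → (if b then _ ^ r else 1#) ≈ (if b then _ ^ r else 1#)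
    descentPower-cong true  = ^-congˡ r x≈y
    descentPower-cong false = ≈-refl

  -- The result involves the successor's letter `L` but no longer its colour `d`, which is what
  -- allows the colours to be eliminated one by one.
  sum-factor : ∀ {x} → Small x → ∀ k L d → d ℕ.< r →
    sum {r} (λ c → factor (suc k , suc (toℕ c)) (L , suc d) x) ≈
    (if L <ᵇ suc k then x else 1#) * (1# - x) ⁻¹
  sum-factor {x} x-small k L d d<r = begin
    sum {r} (λ c → factor (suc k , suc (toℕ c)) (L , suc d) x)
      ≈⟨ sum-cong {r} (λ c → *-congʳ (*-congˡ (reflexive (cong (λ b → if b then x ^ r else 1#)
           (does-descent L (suc k) (toℕ c) d _ (difference%≡0⇒≡ r (Fin.toℕ<n c) d<r)))))) ⟩
    Σ< r (λ c → F ((ℤ.+ suc c ℤ.- ℤ.+ suc d) %ℕ r) * (1# - x ^ r) ⁻¹)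
      ≈⟨ *-distribʳ-sum {r} _ _ ⟨
    Σ< r (λ c → F ((ℤ.+ suc c ℤ.- ℤ.+ suc d) %ℕ r)) * (1# - x ^ r) ⁻¹
      ≈⟨ *-congʳ (≈-trans (Σ<-difference r d d<r F) (geometric-descent x r (L <ᵇ suc k))) ⟩
    (if L <ᵇ suc k then x else 1#) * Σ< r (x ^_) * (1# - x ^ r) ⁻¹
      ≈⟨ *-assoc _ _ _ ⟩
    (if L <ᵇ suc k then x else 1#) * (Σ< r (x ^_) * (1# - x ^ r) ⁻¹)
      ≈⟨ *-congˡ (geometric-÷ x-small r) ⟩
    (if L <ᵇ suc k then x else 1#) * (1# - x) ⁻¹ ∎
    where
    F : ℕ → Carrier
    F a = x ^ a * (if (L <ᵇ suc k) ∧ (a ≡ᵇ 0) then x ^ r else 1#)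

  -- The start x is arbitrary because stripping a first letter k turns it into x z_k.
  prefix : ∀ {M} → Carrier → Word n r M → Fin M → Carrier
  prefix x w i = x * ∏ {suc (toℕ i)} λ j → z (proj₁ (lookup w (Fin.inject≤ j (Fin.toℕ<n i))))

  weight : ∀ {M} → Carrier → Word n r M → Carrier
  weight {M} x w = ∏ {M} λ i → factor (current w i) (next w i) (prefix x w i)

  colouredLetter : Fin n → Fin r → ColouredLetter
  colouredLetter k c = suc (toℕ k) , suc (toℕ c)

  weight-∷ : ∀ {M} x k c (w : Word n r M) →
    weight x ((k , c) ∷ w) ≈
    factor (colouredLetter k c) (lookup (extend w) zero) (x * z k) * weight (x * z k) w
  weight-∷ {M} x k c w = *-cong
    (factor-cong (colouredLetter k c) (lookup (extend w) zero) (*-congˡ (*-identityʳ (z k))))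
    (∏-cong {M} λ i → factor-cong (current w i) (next w i) (≈-sym (*-assoc x (z k) _)))

  -- The factor of the letter κ in front of the word, after summing over its colours. Before the
  -- empty word it precedes n+1, so there is no descent whatever κ is.
  initialFactor : ∀ {M} → ℕ → Carrier → Word n r M → Carrier
  initialFactor κ x []            = (1# - x) ⁻¹
  initialFactor κ x ((l , d) ∷ w) = descentFactor κ x l * (1# - x) ⁻¹

  sum-factor-extend : ∀ {M} {x} → Small x → ∀ k (w : Word n r M) →
    sum {r} (λ c → factor (colouredLetter k c) (lookup (extend w) zero) x) ≈ initialFactor (toℕ k) x w
  sum-factor-extend {x = x} x-small k [] = begin
    sum {r} (λ c → factor (colouredLetter k c) (suc n , 1) x)
      -- Colour 1 of the appended letter is d = 0, and 0 < r since r is nonzero.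
      ≈⟨ sum-factor x-small (toℕ k) (suc n) 0 (ℕ.>-nonZero⁻¹ r) ⟩
    (if n <ᵇ toℕ k then x else 1#) * (1# - x) ⁻¹
      ≈⟨ *-congʳ (reflexive (cong (λ b → if b then x else 1#) (<ᵇ-false (ℕ.<⇒≤ (Fin.toℕ<n k))))) ⟩
    1# * (1# - x) ⁻¹
      ≈⟨ *-identityˡ _ ⟩
    (1# - x) ⁻¹ ∎
  sum-factor-extend x-small k ((l , d) ∷ w) =
    sum-factor x-small (toℕ k) (suc (toℕ l)) (toℕ d) (Fin.toℕ<n d)

  -- Here the letter in front has already been summed over its colours; in `sum-Σˡ-words` they are
  -- still to be summed. Stripping the first letter of the word leads from here to the other form,
  -- at length one less, and summing the colours leads back.
  Σˡ-words : ∀ M mult → Vec.sum mult ≡ M → ∀ {κ} → κ ℕ.≤ n → ∀ {x} → Small x →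
    Σˡ (words r mult M) (λ w → initialFactor κ x w * weight x w) ≈ familySeries mult κ x
  sum-Σˡ-words : ∀ M mult → Vec.sum mult ≡ M → ∀ k {x} → Small x →
    sum {r} (λ c → Σˡ (words r mult M) (λ w → factor (colouredLetter k c) (lookup (extend w) zero) x * weight x w)) ≈
    familySeries mult (toℕ k) x

  Σˡ-words zero mult sum≡0 {κ} κ≤n {x} x-small = begin
    Σˡ (words r mult 0) (λ w → initialFactor κ x w * weight x w)
      ≡⟨ cong (λ ws → Σˡ ws (λ w → initialFactor κ x w * weight x w)) words≡[[]] ⟩
    (1# - x) ⁻¹ * 1# + 0#
      ≈⟨ ≈-trans (+-identityʳ _) (*-identityʳ _) ⟩
    (1# - x) ⁻¹
      ≈⟨ familySeries-empty mult sum≡0 κ x-small ⟨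
    familySeries mult κ x ∎
    where
    words≡[[]] : words r mult 0 ≡ [] ∷ []
    words≡[[]] rewrite dec-true (hasMultiplicities? {r = r} mult []) (λ k → sym (lookup≡0 mult sum≡0 k)) = refl
  Σˡ-words (suc M) mult sum≡ {κ} κ≤n {x} x-small = begin
    Σˡ (words r mult (suc M)) (λ w → initialFactor κ x w * weight x w)
      ≈⟨ Σˡ-words-suc mult _ ⟩
    sum {n} (λ l → positive (lookup mult l) * sum {r} (λ d → Σˡ (words r (mult ∖ l) M)
      (λ w → descentFactor κ x l * (1# - x) ⁻¹ * weight x ((l , d) ∷ w))))
      ≈⟨ sum-cong {n} by-letter ⟩
    sum {n} (λ l → positive (lookup mult l) *
      (descentFactor κ x l * (1# - x) ⁻¹ * familySeries (mult ∖ l) (toℕ l) (x * z l)))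
      ≈⟨ familySeries-rec mult sum≡ κ≤n x-small ⟨
    familySeries mult κ x ∎
    where
    by-letter : ∀ l →
      positive (lookup mult l) * sum {r} (λ d → Σˡ (words r (mult ∖ l) M)
        (λ w → descentFactor κ x l * (1# - x) ⁻¹ * weight x ((l , d) ∷ w))) ≈
      positive (lookup mult l) *
        (descentFactor κ x l * (1# - x) ⁻¹ * familySeries (mult ∖ l) (toℕ l) (x * z l))
    by-letter l with lookup mult l in eq
    ... | zero  = ≈-trans (zeroˡ _) (≈-sym (zeroˡ _))
    ... | suc _ = *-congˡ (begin
      sum {r} (λ d → Σˡ (words r (mult ∖ l) M) (λ w → a * weight x ((l , d) ∷ w)))
        ≈⟨ sum-cong {r} (λ d → ≈-trans
             (Σˡ-cong (words r (mult ∖ l) M) (λ w → *-congˡ (weight-∷ x l d w)))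
             (≈-sym (*-distribˡ-Σˡ a (words r (mult ∖ l) M) _))) ⟩
      sum {r} (λ d → a * Σˡ (words r (mult ∖ l) M)
        (λ w → factor (colouredLetter l d) (lookup (extend w) zero) (x * z l) * weight (x * z l) w))
        ≈⟨ *-distribˡ-sum {r} a _ ⟨
      a * sum {r} (λ d → Σˡ (words r (mult ∖ l) M)
        (λ w → factor (colouredLetter l d) (lookup (extend w) zero) (x * z l) * weight (x * z l) w))
        ≈⟨ *-congˡ (sum-Σˡ-words M (mult ∖ l) (ℕ.suc-injective (trans (suc-sum-∖ mult l eq) sum≡)) l (small-* x-small (z l))) ⟩
      a * familySeries (mult ∖ l) (toℕ l) (x * z l) ∎)
      where
      a : Carrier
      a = descentFactor κ x l * (1# - x) ⁻¹

  sum-Σˡ-words M mult sum≡M k {x} x-small = begin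
    sum {r} (λ c → Σˡ (words r mult M) (λ w → factor (colouredLetter k c) (lookup (extend w) zero) x * weight x w))
      ≈⟨ sum-Σˡ-comm {n = r} (words r mult M) _ ⟩
    Σˡ (words r mult M) (λ w → sum {r} (λ c → factor (colouredLetter k c) (lookup (extend w) zero) x * weight x w))
      ≈⟨ Σˡ-cong (words r mult M) (λ w → ≈-trans (≈-sym (*-distribʳ-sum {r} _ _))
           (*-congʳ (sum-factor-extend x-small k w))) ⟩
    Σˡ (words r mult M) (λ w → initialFactor (toℕ k) x w * weight x w)
      ≈⟨ Σˡ-words M mult sum≡M (ℕ.<⇒≤ (Fin.toℕ<n k)) x-small ⟩
    familySeries mult (toℕ k) x ∎

  numerator : ∀ {M} → Carrier → Word n r M → Carrier
  numerator {M} x w =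
    ∏ {M} (λ i → prefix x w i ^ difference (current w i) (next w i)) *
    ∏ {M} (λ i → descentPower (current w i) (next w i) (prefix x w i))

  denominator : ∀ {M} → Carrier → Word n r M → Carrier
  denominator {M} x w = (1# - x) * ∏ {M} (λ i → 1# - prefix x w i ^ r)

  -- The denominator cancels position by position against the inverses inside `factor`, and 1 - x
  -- against `initialFactor 0`, as no letter lies below 0.
  numerator÷denominator : ∀ {M} {x} → Small x → ∀ (w : Word n r M) →
    numerator x w * denominator x w ⁻¹ ≈ initialFactor 0 x w * weight x w
  numerator÷denominator {M} {x} x-small w = ≈-sym (*-unique
    (*-unital (1-small x-small) (∏-unital {M} _ λ i → 1-prefix^r i)) (begin
    denominator x w * (initialFactor 0 x w * weight x w)
      ≈⟨ *-congˡ (*-congʳ (initialFactor₀ w)) ⟩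
    (1# - x) * ∏ {M} e * ((1# - x) ⁻¹ * weight x w)
      ≈⟨ *.interchange _ _ _ _ ⟩
    (1# - x) * (1# - x) ⁻¹ * (∏ {M} e * weight x w)
      ≈⟨ *-congʳ (*-inverseʳ (1-small x-small)) ⟩
    1# * (∏ {M} e * weight x w)
      ≈⟨ *-identityˡ _ ⟩
    ∏ {M} e * weight x w
      ≈⟨ ∏-distrib-* {M} _ _ ⟨
    ∏ {M} (λ i → e i * factor (current w i) (next w i) (prefix x w i))
      ≈⟨ ∏-cong {M} (λ i → *-÷-cancel (1-prefix^r i) _) ⟩
    ∏ {M} (λ i → prefix x w i ^ difference (current w i) (next w i) *
                 descentPower (current w i) (next w i) (prefix x w i))
      ≈⟨ ∏-distrib-* {M} _ _ ⟩
    numerator x w ∎))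
    where
    e : Fin M → Carrier
    e i = 1# - prefix x w i ^ r
    1-prefix^r : ∀ i → Unital (1# - prefix x w i ^ r)
    -- Only positive powers of a small element are known to be small, so r is written as a
    -- successor.
    1-prefix^r i = subst (λ s → Unital (1# - prefix x w i ^ s)) (ℕ.suc-pred r)
      (1-small (small-^ (small-* x-small _) (pred r)))
    initialFactor₀ : ∀ {M} (w : Word n r M) → initialFactor 0 x w ≈ (1# - x) ⁻¹
    initialFactor₀ []      = ≈-refl
    initialFactor₀ (_ ∷ _) = *-identityˡ _

  -- At κ = 0 every bound in `families` is `suc t`, where `multisets` is the Gaussian coefficient by
  -- definition.
  Σˡ-colouredPermutations : ∀ (mult : Vec ℕ n) {x} → Small x →
    Σˡ (colouredPermutations mult r) (λ w → numerator x w * denominator x w ⁻¹) ≈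
    series x (λ t → ∏ {n} (λ k → gaussian (z k) (t ℕ.+ lookup mult k) (lookup mult k)))
  Σˡ-colouredPermutations mult x-small = ≈-trans
    (Σˡ-cong (colouredPermutations mult r) (numerator÷denominator x-small))
    (Σˡ-words (Vec.sum mult) mult refl ℕ.z≤n x-small)

-- The commutative ring of power series.

open import Defs

private variable
  A B : Set
  N : ℕ

module ℤ+ = CommutativeSemigroupProperties ℤ.+-commutativeSemigroup

sumℤ-++ : ∀ xs ys → sumℤ (xs List.++ ys) ≡ sumℤ xs ℤ.+ sumℤ ys
sumℤ-++ []       ys = sym (ℤ.+-identityˡ _)
sumℤ-++ (x ∷ xs) ys = trans (cong (ℤ._+_ x) (sumℤ-++ xs ys)) (sym (ℤ.+-assoc x _ _))

sumℤ-map-+ : ∀ (f g : A → ℤ) xs →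
  sumℤ (List.map (λ x → f x ℤ.+ g x) xs) ≡ sumℤ (List.map f xs) ℤ.+ sumℤ (List.map g xs)
sumℤ-map-+ f g []       = refl
sumℤ-map-+ f g (x ∷ xs) =
  trans (cong (ℤ._+_ (f x ℤ.+ g x)) (sumℤ-map-+ f g xs)) (ℤ+.interchange (f x) (g x) _ _)

sumℤ-map-0 : ∀ (xs : List A) → sumℤ (List.map (λ _ → 0ℤ) xs) ≡ 0ℤ
sumℤ-map-0 []       = refl
sumℤ-map-0 (x ∷ xs) = trans (ℤ.+-identityˡ _) (sumℤ-map-0 xs)

sumℤ-map-cong : ∀ {f g : A → ℤ} → (∀ x → f x ≡ g x) → ∀ xs →
  sumℤ (List.map f xs) ≡ sumℤ (List.map g xs)
sumℤ-map-cong f≗g xs = cong sumℤ (List.map-cong f≗g xs)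

map-cartesianProductWith : ∀ {C D : Set} (h : C → D) (f : A → B → C) xs ys →
  List.map h (cartesianProductWith f xs ys) ≡ cartesianProductWith (λ x y → h (f x y)) xs ys
map-cartesianProductWith h f []       ys = refl
map-cartesianProductWith h f (x ∷ xs) ys = trans
  (List.map-++ h (List.map (f x) ys) _)
  (cong₂ List._++_ (sym (List.map-∘ ys)) (map-cartesianProductWith h f xs ys))

cartesianProductWith-mapˡ : ∀ {C D : Set} (f : A → B → C) (g : D → A) xs ys →
  cartesianProductWith f (List.map g xs) ys ≡ cartesianProductWith (λ x → f (g x)) xs ys
cartesianProductWith-mapˡ f g []       ys = refl
cartesianProductWith-mapˡ f g (x ∷ xs) ys =
  cong (List.map (f (g x)) ys List.++_) (cartesianProductWith-mapˡ f g xs ys)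

slice : PowerSeries (suc N) → ℕ → PowerSeries N
slice f i e = f (i ∷ e)

-- Drops the terms free of the first variable and divides the rest by it.
shift : PowerSeries (suc N) → PowerSeries (suc N)
shift f (i ∷ e) = f (suc i ∷ e)

*-zero∷ : ∀ (f g : PowerSeries (suc N)) e → (f * g) (0 ∷ e) ≡ (slice f 0 * slice g 0) e
*-zero∷ f g e = cong sumℤ (trans
  (cong (List.map _) (List.++-identityʳ (List.map (0 ∷_) (below e))))
  (sym (List.map-∘ (below e))))

-- A Leibniz rule for shift; the ring laws follow from it by induction on the
-- exponent of the first variable.
*-suc∷ : ∀ (f g : PowerSeries (suc N)) x e →
  (f * g) (suc x ∷ e) ≡ (slice f 0 * slice g (suc x)) e ℤ.+ (shift f * g) (x ∷ e)
*-suc∷ f g x e = begin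
  sumℤ (List.map h (List.map (0 ∷_) (below e) List.++ cartesianProductWith _∷_ (applyUpTo suc (suc x)) (below e)))
    ≡⟨ cong sumℤ (List.map-++ h (List.map (0 ∷_) (below e)) _) ⟩
  sumℤ (List.map h (List.map (0 ∷_) (below e)) List.++ List.map h (cartesianProductWith _∷_ (applyUpTo suc (suc x)) (below e)))
    ≡⟨ sumℤ-++ (List.map h (List.map (0 ∷_) (below e))) _ ⟩
  sumℤ (List.map h (List.map (0 ∷_) (below e))) ℤ.+ sumℤ (List.map h (cartesianProductWith _∷_ (applyUpTo suc (suc x)) (below e)))
    ≡⟨ cong₂ (λ a b → sumℤ a ℤ.+ sumℤ b) (sym (List.map-∘ (below e))) rest ⟩
  (slice f 0 * slice g (suc x)) e ℤ.+ (shift f * g) (x ∷ e) ∎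
  where
  open ≡-Reasoning
  h : Vec ℕ _ → ℤ
  h d = f d ℤ.* g (zipWith _∸_ (suc x ∷ e) d)
  rest : List.map h (cartesianProductWith _∷_ (applyUpTo suc (suc x)) (below e)) ≡
         List.map (λ d → shift f d ℤ.* g (zipWith _∸_ (x ∷ e) d)) (below (x ∷ e))
  rest = begin
    List.map h (cartesianProductWith _∷_ (applyUpTo suc (suc x)) (below e))
      ≡⟨ map-cartesianProductWith h _∷_ (applyUpTo suc (suc x)) (below e) ⟩
    cartesianProductWith (λ i d → h (i ∷ d)) (applyUpTo suc (suc x)) (below e)
      ≡⟨ cong (λ is → cartesianProductWith (λ i d → h (i ∷ d)) is (below e)) (List.map-upTo suc (suc x)) ⟨
    cartesianProductWith (λ i d → h (i ∷ d)) (List.map suc (upTo (suc x))) (below e)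
      ≡⟨ cartesianProductWith-mapˡ (λ i d → h (i ∷ d)) suc (upTo (suc x)) (below e) ⟩
    cartesianProductWith (λ i d → h (suc i ∷ d)) (upTo (suc x)) (below e)
      ≡⟨ map-cartesianProductWith (λ d → shift f d ℤ.* g (zipWith _∸_ (x ∷ e) d)) _∷_ (upTo (suc x)) (below e) ⟨
    List.map (λ d → shift f d ℤ.* g (zipWith _∸_ (x ∷ e) d)) (below (x ∷ e)) ∎

*-cong : ∀ {f f′ g g′ : PowerSeries N} → f ≈ f′ → g ≈ g′ → f * g ≈ f′ * g′
*-cong f≈f′ g≈g′ e = sumℤ-map-cong (λ d → cong₂ ℤ._*_ (f≈f′ d) (g≈g′ _)) (below e)

*-distribˡ-+ : ∀ (f g h : PowerSeries N) → f * (g + h) ≈ f * g + f * h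
*-distribˡ-+ f g h e = trans
  (sumℤ-map-cong (λ d → ℤ.*-distribˡ-+ (f d) _ _) (below e)) (sumℤ-map-+ _ _ (below e))

*-distribʳ-+ : ∀ (h f g : PowerSeries N) → (f + g) * h ≈ f * h + g * h
*-distribʳ-+ h f g e = trans
  (sumℤ-map-cong (λ d → ℤ.*-distribʳ-+ _ (f d) _) (below e)) (sumℤ-map-+ _ _ (below e))

*-zeroˡ : ∀ (f : PowerSeries N) → 0# * f ≈ 0#
*-zeroˡ f e = sumℤ-map-0 (below e)

-- The mirror image of `*-suc∷`, splitting off the other end of the convolution in the first
-- variable; comparing the two gives commutativity.
*-suc∷ʳ : ∀ (f g : PowerSeries (suc N)) x e →
  (f * g) (suc x ∷ e) ≡ (f * shift g) (x ∷ e) ℤ.+ (slice f (suc x) * slice g 0) e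
*-suc∷ʳ f g zero e = trans (*-suc∷ f g 0 e)
  (cong₂ ℤ._+_ (sym (*-zero∷ f (shift g) e)) (*-zero∷ (shift f) g e))
*-suc∷ʳ f g (suc x) e = begin
  (f * g) (suc (suc x) ∷ e)
    ≡⟨ *-suc∷ f g (suc x) e ⟩
  a ℤ.+ (shift f * g) (suc x ∷ e)
    ≡⟨ cong (ℤ._+_ a) (*-suc∷ʳ (shift f) g x e) ⟩
  a ℤ.+ ((shift f * shift g) (x ∷ e) ℤ.+ b)
    ≡⟨ ℤ.+-assoc a _ b ⟨
  a ℤ.+ (shift f * shift g) (x ∷ e) ℤ.+ b
    ≡⟨ cong (ℤ._+ b) (*-suc∷ f (shift g) x e) ⟨
  (f * shift g) (suc x ∷ e) ℤ.+ b ∎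
  where
  open ≡-Reasoning
  a b : ℤ
  a = (slice f 0 * slice g (suc (suc x))) e
  b = (slice f (suc (suc x)) * slice g 0) e

*-comm : ∀ (f g : PowerSeries N) → f * g ≈ g * f
*-comm f g []           = cong (ℤ._+ 0ℤ) (ℤ.*-comm (f []) (g []))
*-comm f g (zero ∷ e)   = trans (*-zero∷ f g e)
  (trans (*-comm (slice f 0) (slice g 0) e) (sym (*-zero∷ g f e)))
*-comm f g (suc x ∷ e) = begin
  (f * g) (suc x ∷ e)
    ≡⟨ *-suc∷ f g x e ⟩
  (slice f 0 * slice g (suc x)) e ℤ.+ (shift f * g) (x ∷ e)
    ≡⟨ cong₂ ℤ._+_ (*-comm (slice f 0) (slice g (suc x)) e) (*-comm (shift f) g (x ∷ e)) ⟩
  (slice g (suc x) * slice f 0) e ℤ.+ (g * shift f) (x ∷ e)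
    ≡⟨ ℤ.+-comm ((slice g (suc x) * slice f 0) e) _ ⟩
  (g * shift f) (x ∷ e) ℤ.+ (slice g (suc x) * slice f 0) e
    ≡⟨ *-suc∷ʳ g f x e ⟨
  (g * f) (suc x ∷ e) ∎
  where open ≡-Reasoning

-- The product with a series free of the first variable. It arises in associativity because
-- `shift (f * g)` is `scale (slice f 0) (shift g) + shift f * g`.
scale : PowerSeries N → PowerSeries (suc N) → PowerSeries (suc N)
scale a g (i ∷ e) = (a * slice g i) e

mutual
  -- Associativity for a first factor free of the first variable. It reduces to associativity in one
  -- variable fewer, hence the mutual induction.
  scale-* : ∀ (a : PowerSeries N) (g h : PowerSeries (suc N)) → scale a g * h ≈ scale a (g * h)
  scale-* a g h (zero ∷ e) = begin
    (scale a g * h) (0 ∷ e)             ≡⟨ *-zero∷ (scale a g) h e ⟩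
    (a * slice g 0 * slice h 0) e       ≡⟨ *-assoc a (slice g 0) (slice h 0) e ⟩
    (a * (slice g 0 * slice h 0)) e     ≡⟨ *-cong {f = a} (λ _ → refl) (*-zero∷ g h) e ⟨
    (a * slice (g * h) 0) e             ∎
    where open ≡-Reasoning
  scale-* a g h (suc x ∷ e) = begin
    (scale a g * h) (suc x ∷ e)
      ≡⟨ *-suc∷ (scale a g) h x e ⟩
    (a * slice g 0 * slice h (suc x)) e ℤ.+ (shift (scale a g) * h) (x ∷ e)
      ≡⟨ cong₂ ℤ._+_ (*-assoc a (slice g 0) (slice h (suc x)) e)
           (*-cong {f = shift (scale a g)} {scale a (shift g)} {h} (λ { (_ ∷ _) → refl }) (λ _ → refl) (x ∷ e)) ⟩
    (a * (slice g 0 * slice h (suc x))) e ℤ.+ (scale a (shift g) * h) (x ∷ e)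
      ≡⟨ cong (ℤ._+_ ((a * (slice g 0 * slice h (suc x))) e)) (scale-* a (shift g) h (x ∷ e)) ⟩
    (a * (slice g 0 * slice h (suc x))) e ℤ.+ (a * slice (shift g * h) x) e
      ≡⟨ *-distribˡ-+ a (slice g 0 * slice h (suc x)) (slice (shift g * h) x) e ⟨
    (a * (slice g 0 * slice h (suc x) + slice (shift g * h) x)) e
      ≡⟨ *-cong {f = a} (λ _ → refl) (*-suc∷ g h x) e ⟨
    (a * slice (g * h) (suc x)) e ∎
    where open ≡-Reasoning

  *-assoc : ∀ (f g h : PowerSeries N) → f * g * h ≈ f * (g * h)
  *-assoc f g h [] = trans (ℤ.+-identityʳ _) (trans (cong (ℤ._* h []) (ℤ.+-identityʳ (f [] ℤ.* g [])))
    (trans (ℤ.*-assoc (f []) (g []) (h []))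
      (sym (trans (ℤ.+-identityʳ _) (cong (f [] ℤ.*_) (ℤ.+-identityʳ (g [] ℤ.* h [])))))))
  *-assoc f g h (zero ∷ e) = begin
    (f * g * h) (0 ∷ e)                       ≡⟨ *-zero∷ (f * g) h e ⟩
    (slice (f * g) 0 * slice h 0) e           ≡⟨ *-cong {g = slice h 0} (*-zero∷ f g) (λ _ → refl) e ⟩
    (slice f 0 * slice g 0 * slice h 0) e     ≡⟨ *-assoc (slice f 0) (slice g 0) (slice h 0) e ⟩
    (slice f 0 * (slice g 0 * slice h 0)) e   ≡⟨ *-cong {f = slice f 0} (λ _ → refl) (*-zero∷ g h) e ⟨
    (slice f 0 * slice (g * h) 0) e           ≡⟨ *-zero∷ f (g * h) e ⟨
    (f * (g * h)) (0 ∷ e)                     ∎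
    where open ≡-Reasoning
  *-assoc f g h (suc x ∷ e) = begin
    (f * g * h) (suc x ∷ e)
      ≡⟨ *-suc∷ (f * g) h x e ⟩
    (slice (f * g) 0 * slice h (suc x)) e ℤ.+ (shift (f * g) * h) (x ∷ e)
      ≡⟨ cong₂ ℤ._+_ (*-cong {g = slice h (suc x)} (*-zero∷ f g) (λ _ → refl) e)
           (*-cong {f = shift (f * g)} {scale (slice f 0) (shift g) + shift f * g} {h} (λ { (i ∷ d) → *-suc∷ f g i d }) (λ _ → refl) (x ∷ e)) ⟩
    (slice f 0 * slice g 0 * slice h (suc x)) e ℤ.+
      ((scale (slice f 0) (shift g) + shift f * g) * h) (x ∷ e)
      ≡⟨ cong₂ ℤ._+_ (*-assoc (slice f 0) (slice g 0) (slice h (suc x)) e)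
           (*-distribʳ-+ h (scale (slice f 0) (shift g)) (shift f * g) (x ∷ e)) ⟩
    a ℤ.+ ((scale (slice f 0) (shift g) * h) (x ∷ e) ℤ.+ (shift f * g * h) (x ∷ e))
      ≡⟨ cong (ℤ._+_ a) (cong₂ ℤ._+_ (scale-* (slice f 0) (shift g) h (x ∷ e))
           (*-assoc (shift f) g h (x ∷ e))) ⟩
    a ℤ.+ ((slice f 0 * slice (shift g * h) x) e ℤ.+ (shift f * (g * h)) (x ∷ e))
      ≡⟨ ℤ.+-assoc a _ _ ⟨
    a ℤ.+ (slice f 0 * slice (shift g * h) x) e ℤ.+ (shift f * (g * h)) (x ∷ e)
      ≡⟨ cong (ℤ._+ (shift f * (g * h)) (x ∷ e)) (trans
           (sym (*-distribˡ-+ (slice f 0) (slice g 0 * slice h (suc x)) (slice (shift g * h) x) e))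
           (sym (*-cong {f = slice f 0} (λ _ → refl) (*-suc∷ g h x) e))) ⟩
    (slice f 0 * slice (g * h) (suc x)) e ℤ.+ (shift f * (g * h)) (x ∷ e)
      ≡⟨ *-suc∷ f (g * h) x e ⟨
    (f * (g * h)) (suc x ∷ e) ∎
    where
    open ≡-Reasoning
    a : ℤ
    a = (slice f 0 * (slice g 0 * slice h (suc x))) e

*-identityˡ : ∀ (f : PowerSeries N) → 1# * f ≈ f
*-identityˡ f []          = trans (ℤ.+-identityʳ _) (ℤ.*-identityˡ _)
*-identityˡ f (zero ∷ e)  = trans (*-zero∷ 1# f e) (*-identityˡ (slice f 0) e)
*-identityˡ f (suc x ∷ e) = begin
  (1# * f) (suc x ∷ e)
    ≡⟨ *-suc∷ 1# f x e ⟩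
  (1# * slice f (suc x)) e ℤ.+ (shift 1# * f) (x ∷ e)
    ≡⟨ cong₂ ℤ._+_ (*-identityˡ (slice f (suc x)) e)
         (*-cong {f = shift 1#} {0#} {f} (λ { (_ ∷ _) → refl }) (λ _ → refl) (x ∷ e)) ⟩
  f (suc x ∷ e) ℤ.+ (0# * f) (x ∷ e)
    ≡⟨ cong (ℤ._+_ (f (suc x ∷ e))) (*-zeroˡ f (x ∷ e)) ⟩
  f (suc x ∷ e) ℤ.+ 0ℤ
    ≡⟨ ℤ.+-identityʳ _ ⟩
  f (suc x ∷ e) ∎
  where open ≡-Reasoning

powerSeriesRing : ℕ → CommutativeRing 0ℓ 0ℓ
powerSeriesRing N = record
  { Carrier = PowerSeries N
  ; _≈_ = _≈_
  ; _+_ = _+_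
  ; _*_ = _*_
  ; -_  = -_
  ; 0#  = 0#
  ; 1#  = 1#
  ; isCommutativeRing = record
    { isRing = record
      { +-isAbelianGroup = record
        { isGroup = record
          { isMonoid = record
            { isSemigroup = record
              { isMagma = record
                { isEquivalence = record
                  { refl  = λ _ → refl
                  ; sym   = λ p e → sym (p e)
                  ; trans = λ p q e → trans (p e) (q e)
                  }
                ; ∙-cong = λ p q e → cong₂ ℤ._+_ (p e) (q e)
                }
              ; assoc = λ f g h e → ℤ.+-assoc (f e) (g e) (h e)
              }
            ; identity = (λ f e → ℤ.+-identityˡ (f e)) , (λ f e → ℤ.+-identityʳ (f e))
            }
          ; inverse = (λ f e → ℤ.+-inverseˡ (f e)) , (λ f e → ℤ.+-inverseʳ (f e))
          ; ⁻¹-cong = λ p e → cong ℤ.-_ (p e)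
          }
        ; comm = λ f g e → ℤ.+-comm (f e) (g e)
        }
      ; *-cong = *-cong
      ; *-assoc = *-assoc
      ; *-identity = *-identityˡ , λ f e → trans (*-comm f 1# e) (*-identityˡ f e)
      ; distrib = *-distribˡ-+ , *-distribʳ-+
      }
    ; *-comm = *-comm
    }
  }

-- Order of vanishing and infinite sums.

module ℕ+ = CommutativeSemigroupProperties ℕ.+-commutativeSemigroup

All-below-degree : (e : Vec ℕ N) →
  All (λ d → degree d ℕ.+ degree (zipWith _∸_ e d) ≡ degree e) (below e)
All-below-degree []      = refl ∷ []
All-below-degree (x ∷ e) =
  All.cartesianProductWith⁺ (≡.setoid _) (≡.setoid _) _∷_ (upTo (suc x)) (below e)
    λ {y} {d} y∈ d∈ → trans (ℕ+.interchange y (degree d) (x ∸ y) _)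
      (cong₂ ℕ._+_ (ℕ.m+[n∸m]≡n (ℕ.≤-pred (∈-upTo⁻ y∈))) (All.lookup (All-below-degree e) d∈))

-- A coefficient of a product sees only exponents whose degrees add up to its own, so an infinite
-- sum may be replaced there by a partial sum.
*-local-cong : ∀ (f f′ g g′ : PowerSeries N) e →
  (∀ d → degree d ℕ.+ degree (zipWith _∸_ e d) ≡ degree e →
     f d ℤ.* g (zipWith _∸_ e d) ≡ f′ d ℤ.* g′ (zipWith _∸_ e d)) →
  (f * g) e ≡ (f′ * g′) e
*-local-cong f f′ g g′ e eq = go (All-below-degree e)
  where
  go : ∀ {ds} → All (λ d → degree d ℕ.+ degree (zipWith _∸_ e d) ≡ degree e) ds →
       sumℤ (List.map (λ d → f d ℤ.* g (zipWith _∸_ e d)) ds) ≡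
       sumℤ (List.map (λ d → f′ d ℤ.* g′ (zipWith _∸_ e d)) ds)
  go []       = refl
  go (p ∷ ps) = cong₂ ℤ._+_ (eq _ p) (go ps)

constantTerm : PowerSeries N → ℤ
constantTerm f = f (Vec.replicate _ 0)

constantTerm-* : ∀ (f g : PowerSeries N) → constantTerm (f * g) ≡ constantTerm f ℤ.* constantTerm g
constantTerm-* {zero}  f g = ℤ.+-identityʳ _
constantTerm-* {suc N} f g = trans (*-zero∷ f g (Vec.replicate N 0)) (constantTerm-* (slice f 0) (slice g 0))

constantTerm-1# : ∀ N → constantTerm (1# {N}) ≡ 1ℤ
constantTerm-1# zero    = refl
constantTerm-1# (suc N) = constantTerm-1# N

degree≡0⇒≡0 : (e : Vec ℕ N) → degree e ≡ 0 → e ≡ Vec.replicate N 0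
degree≡0⇒≡0 []         _  = refl
degree≡0⇒≡0 (zero ∷ e) eq = cong (0 ∷_) (degree≡0⇒≡0 e eq)

Order≥ : ℕ → PowerSeries N → Set
Order≥ k f = ∀ e → degree e ℕ.< k → f e ≡ 0ℤ

Order≥-*ˡ : ∀ {k} (f g : PowerSeries N) → Order≥ k g → Order≥ k (f * g)
Order≥-*ˡ f g g≥k e e<k = trans (*-local-cong f f g 0# e λ d eq → cong (f d ℤ.*_)
  (g≥k _ (ℕ.≤-<-trans (ℕ.≤-trans (ℕ.m≤n+m _ (degree d)) (ℕ.≤-reflexive eq)) e<k)))
  (CommutativeRing.zeroʳ (powerSeriesRing _) f e)

Order≥-*ʳ : ∀ {k} (f g : PowerSeries N) → Order≥ k f → Order≥ k (f * g)
Order≥-*ʳ f g f≥k e e<k = trans (*-comm f g e) (Order≥-*ˡ g f f≥k e e<k)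

-- Either the exponent taken from `f` has degree 0, where `f` vanishes, or the complementary one has
-- degree below k, where `g` vanishes.
Order≥-suc : ∀ {k} (f g : PowerSeries N) → constantTerm f ≡ 0ℤ → Order≥ k g → Order≥ (suc k) (f * g)
Order≥-suc f g f₀ g≥k e e<1+k =
  trans (*-local-cong f 0# g g e vanish) (*-zeroˡ g e)
  where
  vanish : ∀ d → degree d ℕ.+ degree (zipWith _∸_ e d) ≡ degree e →
           f d ℤ.* g (zipWith _∸_ e d) ≡ 0ℤ ℤ.* g (zipWith _∸_ e d)
  vanish d eq with degree d in deg
  ... | zero  = cong (ℤ._* g (zipWith _∸_ e d)) (trans (cong f (degree≡0⇒≡0 d deg)) f₀)
  ... | suc j = trans
    (cong (f d ℤ.*_) (g≥k _
      (ℕ.<-≤-trans (ℕ.s≤s (ℕ.m≤n+m _ j)) (ℕ.≤-trans (ℕ.≤-reflexive eq) (ℕ.≤-pred e<1+k)))))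
    (ℤ.*-zeroʳ (f d))

Order≥-^ : ∀ (f : PowerSeries N) → constantTerm f ≡ 0ℤ → ∀ k → Order≥ k (f ^ k)
Order≥-^ f f₀ zero    e ()
Order≥-^ f f₀ (suc k) = Order≥-suc f (f ^ k) f₀ (Order≥-^ f f₀ k)

Σ∞-cong : ∀ {f g : ℕ → PowerSeries N} → (∀ t → f t ≈ g t) → Σ∞ f ≈ Σ∞ g
Σ∞-cong {f = f} {g} f≈g e = go f g f≈g (suc (degree e))
  where
  go : ∀ (f g : ℕ → PowerSeries _) → (∀ t → f t ≈ g t) → ∀ M →
       sumℤ (applyUpTo (λ t → f t e) M) ≡ sumℤ (applyUpTo (λ t → g t e) M)
  go f g f≈g zero    = refl
  go f g f≈g (suc M) = cong₂ ℤ._+_ (f≈g 0 e) (go (f ∘ suc) (g ∘ suc) (f≈g ∘ suc) M)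

Σ∞-+ : ∀ (f g : ℕ → PowerSeries N) → Σ∞ (λ t → f t + g t) ≈ Σ∞ f + Σ∞ g
Σ∞-+ f g e = go f g (suc (degree e))
  where
  go : ∀ (f g : ℕ → PowerSeries _) M → sumℤ (applyUpTo (λ t → f t e ℤ.+ g t e) M) ≡
       sumℤ (applyUpTo (λ t → f t e) M) ℤ.+ sumℤ (applyUpTo (λ t → g t e) M)
  go f g zero    = refl
  go f g (suc M) = trans (cong (ℤ._+_ (f 0 e ℤ.+ g 0 e)) (go (f ∘ suc) (g ∘ suc) M))
    (ℤ+.interchange (f 0 e) (g 0 e) _ _)

-- At a given exponent the right side contains one term more than the left, and its index exceeds
-- the degree.
Σ∞-suc : ∀ (f : ℕ → PowerSeries N) → (∀ t → Order≥ t (f t)) → Σ∞ f ≈ f 0 + Σ∞ (f ∘ suc)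
Σ∞-suc f f≥ e = sym (Σ∞-converges f f≥ e (suc (suc (degree e))) (ℕ.s≤s (ℕ.n≤1+n _)))

-- `Σ∞` truncates at a point that varies with the exponent inside the convolution. Convergence
-- permits one common truncation, and a finite sum distributes.
*-Σ∞ : ∀ (g : PowerSeries N) (f : ℕ → PowerSeries N) → (∀ t → Order≥ t (f t)) →
  g * Σ∞ f ≈ Σ∞ (λ t → g * f t)
*-Σ∞ {N} g f f≥ e = trans
  (*-local-cong g g (Σ∞ f) (partialSum f (suc (degree e))) e λ d eq → cong (g d ℤ.*_)
    (sym (Σ∞-converges f f≥ _ (suc (degree e))
      (ℕ.s≤s (ℕ.≤-trans (ℕ.m≤n+m _ (degree d)) (ℕ.≤-reflexive eq))))))
  (*-partialSum f (suc (degree e)) e)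
  where
  partialSum : (ℕ → PowerSeries N) → ℕ → PowerSeries N
  partialSum f M d = sumℤ (applyUpTo (λ t → f t d) M)
  *-partialSum : ∀ f M → g * partialSum f M ≈ partialSum (λ t → g * f t) M
  *-partialSum f zero    e = CommutativeRing.zeroʳ (powerSeriesRing N) g e
  *-partialSum f (suc M) e = trans (*-distribˡ-+ g (f 0) (partialSum (f ∘ suc) M) e)
    (cong (ℤ._+_ ((g * f 0) e)) (*-partialSum (f ∘ suc) M e))

powerSeriesSeriesRing : ℕ → SeriesRing
powerSeriesSeriesRing N = record
  { commutativeRing = powerSeriesRing N
  ; _⁻¹         = _⁻¹
  ; series      = λ f a → Σ∞ (λ t → f ^ t * a t)
  ; Unital      = λ f → constantTerm f ≡ 1ℤ
  ; Small       = λ f → constantTerm f ≡ 0ℤ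
  ; ⁻¹-cong     = λ f≈g → Σ∞-cong λ k →
      Exp.^-congˡ commutativeSemiring k λ e → cong (λ a → 1# e ℤ.- a) (f≈g e)
  ; *-inverseʳ  = λ {f} → *-inverseʳ f
  ; 1#-unital   = constantTerm-1# N
  ; *-unital    = λ {f} {g} f₀ g₀ → trans (constantTerm-* f g) (cong₂ ℤ._*_ f₀ g₀)
  ; 1-small     = λ f₀ → cong₂ ℤ._-_ (constantTerm-1# N) f₀
  ; small-*     = λ {f} f₀ g → trans (constantTerm-* f g) (cong (ℤ._* constantTerm g) f₀)
  ; series-cong = Σ∞-cong
  ; series-+    = λ f a b e → trans
      (Σ∞-cong (λ t → *-distribˡ-+ (f ^ t) (a t) (b t)) e)
      (Σ∞-+ (λ t → f ^ t * a t) (λ t → f ^ t * b t) e)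
  ; series-suc  = λ {f} f₀ a → series-suc f f₀ a
  }
  where
  open CommutativeRing (powerSeriesRing N) using (commutativeSemiring)
  order : ∀ (f : PowerSeries N) → constantTerm f ≡ 0ℤ → ∀ a t → Order≥ t (f ^ t * a t)
  order f f₀ a t = Order≥-*ʳ (f ^ t) (a t) (Order≥-^ f f₀ t)
  series-suc : ∀ (f : PowerSeries N) → constantTerm f ≡ 0ℤ → ∀ (a : ℕ → PowerSeries N) →
    Σ∞ (λ t → f ^ t * a t) ≈ a 0 + f * Σ∞ (λ t → f ^ t * a (suc t))
  series-suc f f₀ a e = trans (Σ∞-suc _ (order f f₀ a) e) (cong₂ ℤ._+_
    (*-identityˡ (a 0) e)
    (trans (Σ∞-cong (λ t → *-assoc f (f ^ t) (a (suc t))) e)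
      (sym (*-Σ∞ f (λ t → f ^ t * a (suc t)) (order f f₀ (a ∘ suc)) e))))

var-small : ∀ {N} (j : Fin N) → constantTerm (var j) ≡ 0ℤ
var-small {N} j = cong (if_then 1ℤ else 0ℤ)
  (dec-false (Vec.≡-dec ℕ._≟_ (Vec.replicate N 0 Vec.[ j ]≔ 1) (Vec.replicate N 0)) λ eq →
    ℕ.1+n≢0 (trans (sym (Vec.lookup∘update j (Vec.replicate N 0) 1))
      (trans (cong (λ d → lookup d j) eq) (Vec.lookup-replicate j 0))))

theorem10 :
    (n : ℕ) → n ℕ.≥ 1 →
    (mult : Vec ℕ n) → (∀ k → lookup mult k ℕ.≥ 1) →
    (r : ℕ) → .{{_ : NonZero r}} →
    Σ-list (colouredPermutations mult r) (λ w → numerator w ÷ denominator w)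
      ≈
    Σ∞ (λ t → var zero ^ t * ∏ {n = n} (λ k → gaussian (var (suc k)) (t ℕ.+ lookup mult k) (lookup mult k)))
theorem10 n _ mult _ r =
  WordSums.Σˡ-colouredPermutations (powerSeriesSeriesRing (suc n)) (λ k → var (suc k))
    (λ k → var-small (suc k)) r mult {x = var zero} (var-small {suc n} zero)
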